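{- Let $n\ge2$ and $k\ge1$ be given integers. Then there exist constants $C_{n,k}$ and $D_{n,k}$ such that, as $d\to\infty$ (over positive integers), $$\mathbb{E}[X_{n,dn+1}^k]=C_{n,k}\,d^{2k}+O(d^{2k-1}),\qquad \mathbb{E}[X_{n,dn-1}^k]=D_{n,k}\,d^{2k}+O(d^{2k-1}).$$
   Context: A partition $\lambda=(\lambda_1\ge\dots\ge\lambda_\ell)$ has size $|\lambda|=\sum_i\lambda_i$. The hook length of a box of its Young diagram is the number of boxes directly to its right, directly below it, plus the box itself. For a positive integer $t$, $\lambda$ is a $t$-core if none of its hook lengths is divisible by $t$; an $(s,t)$-core is both an $s$-core and a $t$-core. For coprime $s,t$, $X_{s,t}$ denotes the size of a partition chosen uniformly at random from the finite set of $(s,t)$-core partitions with distinct parts. -}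

module Defs where

open import Data.Nat as ℕ using (ℕ; zero; suc; _+_; _*_; _∸_; _^_; _<_; _≤_; _<?_)
open import Data.Nat.Divisibility using (_∣_)
open import Data.List using (List; []; _∷_; length; lookup; filter; map)
open import Data.Nat.ListAction using (sum)
open import Data.List.Relation.Unary.All using (All)
open import Data.List.Relation.Unary.Linked using (Linked)
open import Data.List.Relation.Unary.Unique.Propositional using (Unique)
open import Data.List.Membership.Propositional using (_∈_)
open import Data.Fin using (Fin; toℕ)
open import Data.Product using (_×_)
open import Function.Bundles using (_⇔_)
open import Relation.Nullary using (¬_)
open import Data.Integer using (+_)
open import Data.Rational using (ℚ; _/_)

DistinctPartition : List ℕ → Set
DistinctPartition λs = All (0 <_) λs × Linked (λ a b → b < a) λs

size : List ℕ → ℕ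
size = sum

-- conjugate part λ'_{j} (0-indexed column j): number of parts > j
conj : List ℕ → ℕ → ℕ
conj λs j = length (filter (j <?_) λs)

-- hook length of the box in row i, column j (both 0-indexed):
-- arm (λ_i - j - 1) + leg (λ'_j - i - 1) + 1
hook : (λs : List ℕ) → Fin (length λs) → ℕ → ℕ
hook λs i j = (lookup λs i ∸ j ∸ 1) + (conj λs j ∸ toℕ i ∸ 1) + 1

IsCore : ℕ → List ℕ → Set
IsCore t λs = (i : Fin (length λs)) (j : ℕ) → j < lookup λs i → ¬ (t ∣ hook λs i j)

IsSTCoreDistinct : ℕ → ℕ → List ℕ → Set
IsSTCoreDistinct s t λs = DistinctPartition λs × IsCore s λs × IsCore t λs

Enumerates : ℕ → ℕ → List (List ℕ) → Set
Enumerates s t L = Unique L × ((λs : List ℕ) → (λs ∈ L) ⇔ IsSTCoreDistinct s t λs)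

-- k-th moment of the size under the uniform distribution on the list L:
-- (1/|L|) Σ_{λ ∈ L} |λ|^k   (0 for the empty list, which never occurs here)
moment : ℕ → List (List ℕ) → ℚ
moment k [] = + 0 / 1
moment k L@(_ ∷ L') = + sum (map (λ λs → size λs ^ k) L) / suc (length L')

ℕtoℚ : ℕ → ℚ
ℕtoℚ m = + m / 1

{-# OPTIONS --safe #-}

-- Encode λ by its beads λᵢ + (ℓ − 1 − i). The parts are distinct iff no two beads are consecutive,
-- and λ is a t-core iff the beads are closed under subtracting t. Subtracting dn ± 1 from a bead
-- and using closure under n would produce a neighbour of a bead, so for n-cores with distinct parts
-- being a (dn ± 1)-core just means that all beads are below dn ± 1. Such partitions are the vectors
-- of runner lengths (c₁, …, cₙ₋₁) with 0 ≤ cᵢ ≤ d (cₙ₋₁ ≤ d − 1 in the minus case) without two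
-- adjacent nonzero entries, and the size is a polynomial of degree 2 in the cᵢ. Since
-- Σ_{c ≤ d} cᵉ = dᵉ⁺¹/(e+1) + O(dᵉ), the number of these vectors is b dᵍ + O(dᵍ⁻¹) with b > 0 and
-- g = ⌊n/2⌋, and the sum of the k-th powers of the sizes is a d²ᵏ⁺ᵍ + O(d²ᵏ⁺ᵍ⁻¹). So C = a / b, and
-- likewise D.

module Submission where

open import Defs
open import Data.Bool using (Bool; true; false)
open import Data.Fin as Fin using (Fin; zero; suc; toℕ)
open import Data.Fin.Properties using (toℕ-injective; toℕ<n; toℕ-fromℕ<)
import Data.Integer as ℤ
import Data.Integer.Properties as ℤ
open import Data.List as List using (List; []; _∷_; _++_; length; map; filter; applyDownFrom; cartesianProductWith)
open import Data.List.Membership.Propositional using (_∈_; _∉_)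
open import Data.List.Membership.Propositional.Properties
  using (∈-++⁺ˡ; ∈-++⁺ʳ; ∈-++⁻; ∈-map⁺; ∈-map⁻; ∈-lookup; ∈-applyDownFrom⁺; ∈-applyDownFrom⁻;
         ∈-cartesianProductWith⁺; ∈-cartesianProductWith⁻)
open import Data.List.Membership.Propositional.Properties.WithK using (unique∧set⇒bag)
open import Data.List.Properties
  using (filter-accept; filter-none; length-filter; length-++; length-map; length-applyDownFrom; map-++; map-∘)
open import Data.List.Relation.Binary.BagAndSetEquality using (∼bag⇒↭)
open import Data.List.Relation.Binary.Permutation.Propositional using (_↭_; ↭-sym; ↭-trans; ↭⇒↭ₛ)
open import Data.List.Relation.Binary.Permutation.Propositional.Properties
  using (∈-resp-↭; ↭-length) renaming (map⁺ to ↭-map⁺)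
open import Data.List.Relation.Binary.Pointwise using (Pointwise-≡⇒≡)
open import Data.List.Relation.Unary.All as All using (All; []; _∷_)
open import Data.List.Relation.Unary.AllPairs as AllPairs using (AllPairs; []; _∷_)
open import Data.List.Relation.Unary.Any using (here; there)
open import Data.List.Relation.Unary.Linked using (Linked; []; [-]; _∷_)
open import Data.List.Relation.Unary.Linked.Properties using (Linked⇒AllPairs)
open import Data.List.Relation.Unary.Sorted.TotalOrder.Properties using (↗↭↗⇒≋; AllPairs⇒Sorted; Sorted⇒AllPairs)
open import Data.List.Relation.Unary.Unique.Propositional using (Unique)
import Data.List.Relation.Unary.Unique.Propositional.Properties as Unique
open import Data.Nat hiding (∣_-_∣)
import Data.Nat.Coprimality as Coprimality
open import Data.Nat.Divisibility using (_∣_; divides; ∣-refl)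
open import Data.Nat.DivMod using ([m+kn]%n≡m%n; m<n⇒m%n≡m; m≡m%n+[m/n]*n; m%n<n)
open import Data.Nat.ListAction using (sum)
open import Data.Nat.ListAction.Properties using (sum-++; sum-↭)
open import Data.Nat.Properties
open import Data.List.Membership.DecPropositional _≟_ using (_∈?_)
open import Data.Nat.Tactic.RingSolver using (solve-∀)
open import Data.Product using (∃; ∃₂; _×_; _,_; proj₁; proj₂)
open import Data.Rational using (ℚ; mkℚ; *≤*; 0ℚ; 1ℚ; ½; ∣_∣; _-_; 1/_; NonNegative; Positive; nonNegative; positive; toℚᵘ)
  renaming (_+_ to _+ℚ_; _*_ to _*ℚ_; -_ to -ℚ_; _/_ to _/ℚ_; _⊔_ to _⊔ℚ_; _≤_ to _≤ℚ_; _<_ to _<ℚ_)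
import Data.Rational.Properties as ℚ
open import Data.Rational.Solver using (module +-*-Solver)
open import Data.Rational.Unnormalised as ℚᵘ using (mkℚᵘ; *≡*)
import Data.Rational.Unnormalised.Properties as ℚᵘ
open import Data.Sum using (inj₁; inj₂)
open import Data.Vec as Vec using (Vec; []; _∷_)
open import Data.Vec.Properties using (∷-injective)
open import Function using (_∘_; flip)
open import Function.Bundles using (_⇔_; mk⇔; module Equivalence)
open import Relation.Binary.Bundles using (DecTotalOrder)
import Relation.Binary.Construct.Flip.EqAndOrd as Flip
open import Relation.Binary.PropositionalEquality
open import Relation.Nullary using (¬_; Dec; yes; no; contradiction)
import Data.List.Relation.Binary.Permutation.Setoid.Properties (setoid ℕ) as Permutation

open +-*-Solver using (solve; _:+_; _:*_; _:-_; :-_; _:=_; con)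


-- Beads: cores as sets of first-column hook lengths

-- Runner 0 is empty: closure under `n` would bring any bead on it down to 0, while beads are
-- positive. A nonempty runner `i` contains `i` itself, so two adjacent nonempty runners would
-- contain consecutive numbers. As runner 0 is empty, this is a condition along a path of n - 1
-- runners and not around a cycle. At most ⌊n/2⌋ vertices of that path are pairwise nonadjacent.
-- Each contributes one free summation, hence one extra power of d whatever monomial is summed,
-- which is why g is the same in numerator and denominator and cancels. The delicate step is the
-- division. The asymptotics of the count bound it from below only for d beyond a threshold
-- depending on its constants. A direct count gives at least (d/2)ᵍ vectors for every d ≥ 2, and
-- this explicit bound is what the error estimate divides by.

Desc : List ℕ → Set
Desc = AllPairs _>_

Closed : ℕ → List ℕ → Set
Closed t bs = ∀ {y} → y + t ∈ bs → y ∈ bs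

Sparse : List ℕ → Set
Sparse bs = ∀ {y} → y ∈ bs → suc y ∉ bs

beads : List ℕ → List ℕ
beads []       = []
beads (x ∷ xs) = x + length xs ∷ beads xs

parts : List ℕ → List ℕ
parts []       = []
parts (b ∷ bs) = b ∸ length bs ∷ parts bs

length-beads : ∀ xs → length (beads xs) ≡ length xs
length-beads []       = refl
length-beads (x ∷ xs) = cong suc (length-beads xs)

length-parts : ∀ bs → length (parts bs) ≡ length bs
length-parts []       = refl
length-parts (b ∷ bs) = cong suc (length-parts bs)

parts∘beads : ∀ xs → parts (beads xs) ≡ xs
parts∘beads []       = refl
parts∘beads (x ∷ xs) = cong₂ _∷_
  (trans (cong (x + length xs ∸_) (length-beads xs)) (m+n∸n≡m x (length xs)))
  (parts∘beads xs)

length≤head : ∀ {b bs} → Desc (b ∷ bs) → length bs ≤ b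
length≤head {bs = []}    _                   = z≤n
length≤head {bs = _ ∷ _} ((b>c ∷ _) ∷ desc) = ≤-trans (s≤s (length≤head desc)) b>c

length<head : ∀ {b bs} → Desc (b ∷ bs) → All (0 <_) (b ∷ bs) → length bs < b
length<head {bs = []}    _                   (pos ∷ _) = pos
length<head {bs = _ ∷ _} ((b>c ∷ _) ∷ desc) (_ ∷ pos) = ≤-trans (s≤s (length<head desc pos)) b>c

beads∘parts : ∀ {bs} → Desc bs → beads (parts bs) ≡ bs
beads∘parts []                              = refl
beads∘parts {b ∷ bs} desc@(_ ∷ desc-bs) = cong₂ _∷_
  (trans (cong (b ∸ length bs +_) (length-parts bs)) (m∸n+n≡m (length≤head desc)))
  (beads∘parts desc-bs)

-- Passing from beads to parts shrinks the gap between neighbours by one, so strictly decreasing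
-- parts require bead gaps of at least two.
parts-distinct : ∀ {bs} → Desc bs → All (0 <_) bs → Sparse bs → DistinctPartition (parts bs)
parts-distinct desc pos sparse = parts-pos desc pos , decreasing desc sparse
  where
  parts-pos : ∀ {bs} → Desc bs → All (0 <_) bs → All (0 <_) (parts bs)
  parts-pos []                 []                = []
  parts-pos desc@(_ ∷ desc-bs) pos@(_ ∷ pos-bs) =
    m<n⇒0<n∸m (length<head desc pos) ∷ parts-pos desc-bs pos-bs

  decreasing : ∀ {bs} → Desc bs → Sparse bs → Linked (λ a b → b < a) (parts bs)
  decreasing []                 _      = []
  decreasing (_ ∷ [])           _      = [-]
  decreasing {suc b ∷ c ∷ bs} ((s≤s c≤b ∷ _) ∷ desc) sparse =
    ∸-monoˡ-< (≤∧≢⇒< c≤b λ { refl → sparse (there (here refl)) (here refl) }) (length≤head desc)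
    ∷ decreasing desc λ y∈bs → sparse (there y∈bs) ∘ there

-- The part drops by at least one and the number of later parts drops by one, whence a gap of two.
-- Both the order and the sparsity of the beads come from this bound.
beads-< : ∀ {x xs} → All (x >_) xs → Desc xs → All (λ b → suc b < x + length xs) (beads xs)
beads-< []          []           = []
beads-< {x} {p ∷ ps} (x>p ∷ _) (p>ps ∷ desc) =
  <-≤-trans (n<1+n _) bound ∷ All.map (λ b< → <-trans b< bound′) (beads-< p>ps desc)
  where
  bound : 2 + (p + length ps) ≤ x + length (p ∷ ps)
  bound = ≤-trans (s≤s (+-monoˡ-≤ (length ps) x>p)) (≤-reflexive (sym (+-suc x (length ps))))

  bound′ : p + length ps < x + length (p ∷ ps)
  bound′ = <-trans (n<1+n _) bound

beads-desc : ∀ {xs} → Desc xs → Desc (beads xs)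
beads-desc []            = []
beads-desc (x>xs ∷ desc) = All.map (<-trans (n<1+n _)) (beads-< x>xs desc) ∷ beads-desc desc

beads-pos : ∀ {xs} → All (0 <_) xs → All (0 <_) (beads xs)
beads-pos []          = []
beads-pos (pos ∷ all) = ≤-trans pos (m≤m+n _ _) ∷ beads-pos all

beads-sparse : ∀ {xs} → Desc xs → Sparse (beads xs)
beads-sparse (x>xs ∷ desc) (here refl)  (there q)  =
  <-asym (<-trans (n<1+n _) (All.lookup (beads-< x>xs desc) q)) (n<1+n _)
beads-sparse (x>xs ∷ desc) (there p)    (here eq)  = <-irrefl eq (All.lookup (beads-< x>xs desc) p)
beads-sparse (x>xs ∷ desc) (there p)    (there q)  = beads-sparse desc p q
beads-sparse (x>xs ∷ desc) (here refl)  (here eq)  = 1+n≢n eq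

triangle : ℕ → ℕ
triangle zero    = 0
triangle (suc l) = triangle l + l

-- A bead exceeds its part by the number of later parts, and these excesses run through 0, ..., ℓ -
-- 1.
sum-beads : ∀ xs → sum xs + triangle (length xs) ≡ sum (beads xs)
sum-beads []       = refl
sum-beads (x ∷ xs) = begin
  x + sum xs + (triangle l + l)    ≡⟨ rearrange x (sum xs) (triangle l) l ⟩
  x + l + (sum xs + triangle l)    ≡⟨ cong (x + l +_) (sum-beads xs) ⟩
  x + l + sum (beads xs)           ∎
  where
  open ≡-Reasoning
  l = length xs
  rearrange : ∀ a b c d → a + b + (c + d) ≡ a + d + (b + c)
  rearrange = solve-∀

-- The hook lengths in the row of the bead b are the differences b ∸ y over the y < b
-- which are not beads; column j corresponds to y = nonbead xs j, xs being the later rows.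
nonbead : List ℕ → ℕ → ℕ
nonbead xs j = j + (length xs ∸ conj xs j)

conj≤length : ∀ xs j → conj xs j ≤ length xs
conj≤length xs j = length-filter (j <?_) xs

conj-∷ : ∀ {x xs j} → j < x → conj (x ∷ xs) j ≡ suc (conj xs j)
conj-∷ {j = j} j<x = cong length (filter-accept (j <?_) j<x)

nonbead-small : ∀ {xs j} → All (_≤ j) xs → nonbead xs j ≡ j + length xs
nonbead-small {xs} {j} all = cong (λ f → j + (length xs ∸ length f))
  (filter-none (j <?_) (All.map ≤⇒≯ all))

nonbead-∷ : ∀ {x xs j} → j < x → nonbead (x ∷ xs) j ≡ nonbead xs j
nonbead-∷ {x} {xs} {j} j<x = cong (λ c → j + (suc (length xs) ∸ c)) (conj-∷ {xs = xs} j<x)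

nonbead∉ : ∀ {xs} → Desc xs → ∀ j → nonbead xs j ∉ beads xs
nonbead∉ {x ∷ xs} (x>xs ∷ desc) j with j <? x
... | yes j<x = λ
  { (here eq)  → <-irrefl (trans (sym (nonbead-∷ {xs = xs} j<x)) eq)
                   (+-mono-<-≤ j<x (m∸n≤m (length xs) (conj xs j)))
  ; (there y∈) → nonbead∉ desc j (subst (_∈ beads xs) (nonbead-∷ {xs = xs} j<x) y∈) }
... | no j≮x = λ y∈ → <⇒≱ bound (All.lookup (≤-refl ∷ All.map (<⇒≤ ∘ <-trans (n<1+n _)) (beads-< x>xs desc)) y∈)
  where
  x≤j : x ≤ j
  x≤j = ≮⇒≥ j≮x
  bound : x + length xs < nonbead (x ∷ xs) j
  bound = subst (x + length xs <_)
    (sym (nonbead-small (x≤j ∷ All.map (λ x>y → ≤-trans (<⇒≤ x>y) x≤j) x>xs)))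
    (+-mono-≤-< x≤j (n<1+n (length xs)))

-- Prepending a part `x` keeps the value in the columns j < x and raises it by one in the columns j
-- ≥ x, which no later row reaches. Only the value `x + length xs` drops out, and it is the new
-- bead; any other value is found in its old column or the one before.
nonbead-surjective : ∀ {xs} → Desc xs → ∀ {y} → y ∉ beads xs → ∃ λ j → nonbead xs j ≡ y
nonbead-surjective []            {y} _   = y , +-identityʳ y
nonbead-surjective {x ∷ xs} (x>xs ∷ desc) {y} y∉ with nonbead-surjective desc (y∉ ∘ there)
... | j , eq with j <? x
... | yes j<x = j , trans (nonbead-∷ {xs = xs} j<x) eq
... | no j≮x with m≤n⇒m<n∨m≡n (≮⇒≥ j≮x)
...   | inj₂ refl = contradiction (here (trans (sym eq) (nonbead-small (All.map <⇒≤ x>xs)))) y∉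
...   | inj₁ (s≤s {n = j′} x≤j′) = j′ , (begin
  nonbead (x ∷ xs) j′      ≡⟨ nonbead-small (x≤j′ ∷ All.map (λ x>z → ≤-trans (<⇒≤ x>z) x≤j′) x>xs) ⟩
  j′ + suc (length xs)     ≡⟨ +-suc j′ (length xs) ⟩
  suc j′ + length xs       ≡⟨ nonbead-small (All.map (λ x>z → ≤-trans (<⇒≤ x>z) (m≤n⇒m≤1+n x≤j′)) x>xs) ⟨
  nonbead xs (suc j′)      ≡⟨ eq ⟩
  y                        ∎)
  where
  open ≡-Reasoning

hook-zero : ∀ {x xs j} → j < x → hook (x ∷ xs) zero j + nonbead xs j ≡ x + length xs
hook-zero {x} {xs} {j} j<x = begin
  (x ∸ j ∸ 1) + (conj (x ∷ xs) j ∸ 1) + 1 + (j + (l ∸ c))  ≡⟨ cong (λ k → (x ∸ j ∸ 1) + (k ∸ 1) + 1 + (j + (l ∸ c)))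
                                                                    (conj-∷ {xs = xs} j<x) ⟩
  (x ∸ j ∸ 1) + c + 1 + (j + (l ∸ c))  ≡⟨ rearrange (x ∸ j ∸ 1) c j (l ∸ c) ⟩
  suc ((x ∸ j ∸ 1) + j) + (l ∸ c + c)  ≡⟨ cong₂ _+_ shifted (m∸n+n≡m (conj≤length xs j)) ⟩
  x + l                                ∎
  where
  open ≡-Reasoning
  l = length xs
  c = conj xs j
  rearrange : ∀ a c j k → a + c + 1 + (j + k) ≡ suc (a + j) + (k + c)
  rearrange = solve-∀
  shifted : suc ((x ∸ j ∸ 1) + j) ≡ x
  shifted = trans (sym (+-suc (x ∸ j ∸ 1) j)) (trans (cong (_+ suc j) (∸-+-assoc x j 1))
    (trans (cong (λ k → x ∸ k + suc j) (+-comm j 1)) (m∸n+n≡m j<x)))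

hook-suc : ∀ {x xs j} (i : Fin (length xs)) → All (x >_) xs → j < List.lookup xs i →
           hook (x ∷ xs) (suc i) j ≡ hook xs i j
hook-suc {x} {xs} {j} i x>xs j<xᵢ =
  cong (λ c → (List.lookup xs i ∸ j ∸ 1) + (c ∸ suc (toℕ i) ∸ 1) + 1)
       (conj-∷ {xs = xs} (<-trans j<xᵢ (All.lookup x>xs (∈-lookup i))))

-- By induction only the largest bead b needs an argument. If b = y + t and `y` is not a bead, then
-- `y` belongs to a column `j`. For j < x the hook length there is exactly `t`; for j ≥ x the value
-- `y` is at least b.
core⇒closed : ∀ {t xs} → 0 < t → Desc xs → IsCore t xs → Closed t (beads xs)
core⇒closed {t} {x ∷ xs} 0<t (x>xs ∷ desc) core (there y+t∈) =
  there (core⇒closed 0<t desc (λ i j j<xᵢ → core (suc i) j j<xᵢ ∘ subst (t ∣_) (sym (hook-suc i x>xs j<xᵢ))) y+t∈)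
core⇒closed {t} {x ∷ xs} 0<t (x>xs ∷ desc) core {y} (here y+t≡) with y ∈? beads xs
... | yes y∈ = there y∈
... | no y∉ with nonbead-surjective desc y∉
... | j , refl with j <? x
... | yes j<x = contradiction (subst (t ∣_) (sym hook≡t) ∣-refl) (core zero j j<x)
  where
  hook≡t : hook (x ∷ xs) zero j ≡ t
  hook≡t = +-cancelʳ-≡ (nonbead xs j) _ _
    (trans (hook-zero {xs = xs} j<x) (trans (sym y+t≡) (+-comm (nonbead xs j) t)))
... | no j≮x = contradiction bound (<⇒≱ (m<m+n y 0<t))
  where
  x≤j = ≮⇒≥ j≮x
  bound : y + t ≤ y
  bound = begin
    y + t          ≡⟨ y+t≡ ⟩
    x + length xs  ≤⟨ +-monoˡ-≤ (length xs) x≤j ⟩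
    j + length xs  ≡⟨ nonbead-small (All.map (λ x>z → ≤-trans (<⇒≤ x>z) x≤j) x>xs) ⟨
    y              ∎
    where open ≤-Reasoning

closed-* : ∀ {t bs} → Closed t bs → ∀ q {y} → y + q * t ∈ bs → y ∈ bs
closed-* {bs = bs} closed zero    {y} y∈ = subst (_∈ bs) (+-identityʳ y) y∈
closed-* {t} {bs}  closed (suc q) {y} y∈ = closed-* closed q (closed
  (subst (_∈ bs) (trans (cong (y +_) (+-comm t (q * t))) (sym (+-assoc y (q * t) t))) y∈))

-- A hook of length q t connects its bead b with the nonbead b - q t, which `q` steps of closure
-- would turn into a bead.
closed⇒core : ∀ {t xs} → Desc xs → Closed t (beads xs) → IsCore t xs
closed⇒core {t} {x ∷ xs} (x>xs ∷ desc) closed zero j j<x (divides q hook≡) = is-nonbead (closed-* closed q (here shifted))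
  where
  shifted : nonbead xs j + q * t ≡ x + length xs
  shifted = trans (+-comm (nonbead xs j) (q * t))
    (trans (cong (_+ nonbead xs j) (sym hook≡)) (hook-zero {xs = xs} j<x))
  is-nonbead : nonbead xs j ∉ beads (x ∷ xs)
  is-nonbead (here eq)  = <-irrefl eq (+-mono-<-≤ j<x (m∸n≤m (length xs) (conj xs j)))
  is-nonbead (there y∈) = nonbead∉ desc j y∈
closed⇒core {t} {x ∷ xs} (x>xs ∷ desc) closed (suc i) j j<xᵢ =
  closed⇒core desc closed-tail i j j<xᵢ ∘ subst (t ∣_) (hook-suc i x>xs j<xᵢ)
  where
  -- Closure survives the removal of the largest bead: a smaller bead y + t cannot have `y` equal to
  -- it.
  closed-tail : Closed t (beads xs)
  closed-tail {y} y+t∈ with closed (there y+t∈)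
  ... | there y∈  = y∈
  ... | here refl = contradiction (<-trans (n<1+n _) (All.lookup (beads-< x>xs desc) y+t∈)) (≤⇒≯ (m≤m+n y t))

-- Runners of the n-abacus

≥-decTotalOrder : DecTotalOrder _ _ _
≥-decTotalOrder = Flip.decTotalOrder ≤-decTotalOrder

open DecTotalOrder ≥-decTotalOrder using () renaming (totalOrder to ≥-totalOrder)
open import Data.List.Sort ≥-decTotalOrder using (sort; sort-↭; sort-↗)

sort-desc : ∀ {xs} → Unique xs → Desc (sort xs)
sort-desc {xs} uniq = AllPairs.zipWith (λ (y≤x , x≢y) → ≤∧≢⇒< y≤x (x≢y ∘ sym))
  (Sorted⇒AllPairs ≥-totalOrder (sort-↗ xs) , Permutation.Unique-resp-↭ (↭⇒↭ₛ (↭-sym (sort-↭ xs))) uniq)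

desc⇒unique : ∀ {xs} → Desc xs → Unique xs
desc⇒unique = AllPairs.map λ x>y x≡y → <-irrefl (sym x≡y) x>y

desc-↭⇒≡ : ∀ {xs ys} → Desc xs → Desc ys → xs ↭ ys → xs ≡ ys
desc-↭⇒≡ xs↘ ys↘ xs↭ys = Pointwise-≡⇒≡
  (↗↭↗⇒≋ ≥-totalOrder (sorted xs↘) (sorted ys↘) (↭⇒↭ₛ xs↭ys))
  where
  sorted : ∀ {zs} → Desc zs → _
  sorted = AllPairs⇒Sorted ≥-totalOrder ∘ AllPairs.map <⇒≤

unique-⇔⇒↭ : ∀ {A : Set} {xs ys : List A} → Unique xs → Unique ys →
             (∀ {x} → x ∈ xs ⇔ x ∈ ys) → xs ↭ ys
unique-⇔⇒↭ xs! ys! xs⇔ys = ∼bag⇒↭ (unique∧set⇒bag xs! ys! xs⇔ys)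

<-extensional : ∀ {a b} → (∀ {j} → j < a → j < b) → (∀ {j} → j < b → j < a) → a ≡ b
<-extensional {zero}  {zero}  _ _ = refl
<-extensional {zero}  {suc b} _ g = contradiction (g {0} z<s) λ ()
<-extensional {suc a} {zero}  f _ = contradiction (f {0} z<s) λ ()
<-extensional {suc a} {suc b} f g = ≤-antisym (f (n<1+n a)) (g (n<1+n b))

lookup-extensional : ∀ {A : Set} {r} {xs ys : Vec A r} → (∀ p → Vec.lookup xs p ≡ Vec.lookup ys p) → xs ≡ ys
lookup-extensional {xs = []}     {[]}     _  = refl
lookup-extensional {xs = x ∷ xs} {y ∷ ys} eq = cong₂ _∷_ (eq zero) (lookup-extensional (eq ∘ suc))

initial-segment : ∀ {P : ℕ → Set} u → (∀ j → Dec (P j)) → (∀ {j} → P (suc j) → P j) →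
                  (∀ {j} → P j → j < u) → ∃ λ c → c ≤ u × (∀ {j} → P j → j < c) × (∀ {j} → j < c → P j)
initial-segment zero    P? down below = 0 , z≤n , below , λ ()
initial-segment {P} (suc u) P? down below with P? u
... | yes Pu = suc u , ≤-refl , below , λ { (s≤s j≤u) → descend (≤⇒≤′ j≤u) Pu }
  where
  descend : ∀ {j k} → j ≤′ k → P k → P j
  descend ≤′-refl       Pk = Pk
  descend (≤′-step j≤k) Pk = descend j≤k (down Pk)
... | no ¬Pu with initial-segment u P? down
                    (λ Pj → ≤∧≢⇒< (s≤s⁻¹ (below Pj)) λ { refl → ¬Pu Pj })
...   | c , c≤u , to , from = c , m≤n⇒m≤1+n c≤u , to , from

-- The Boolean is a state: `false` right after a nonzero entry, when the next one must be 0. The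
-- number `i` is that of the current runner, whose capacity is `u i`. With the state in the index,
-- every sum over such vectors obeys a two-state recursion.
data Admissible (u : ℕ → ℕ) : ∀ {r} → Bool → ℕ → Vec ℕ r → Set where
  []   : ∀ {b i} → Admissible u b i []
  skip : ∀ {r b i} {cs : Vec ℕ r} → Admissible u true (suc i) cs → Admissible u b i (0 ∷ cs)
  pick : ∀ {r i c} {cs : Vec ℕ r} → c < u i → Admissible u false (suc i) cs →
         Admissible u true i (suc c ∷ cs)

enum : (u : ℕ → ℕ) → Bool → ℕ → (r : ℕ) → List (Vec ℕ r)
enum u b     i zero    = [] ∷ []
enum u false i (suc r) = map (0 ∷_) (enum u true (suc i) r)
enum u true  i (suc r) = map (0 ∷_) (enum u true (suc i) r)
  ++ cartesianProductWith _∷_ (applyDownFrom suc (u i)) (enum u false (suc i) r)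

∈-enum⁺ : ∀ {u r b i} {cs : Vec ℕ r} → Admissible u b i cs → cs ∈ enum u b i r
∈-enum⁺                 []           = here refl
∈-enum⁺ {b = false}     (skip adm)   = ∈-map⁺ (0 ∷_) (∈-enum⁺ adm)
∈-enum⁺ {b = true}      (skip adm)   = ∈-++⁺ˡ (∈-map⁺ (0 ∷_) (∈-enum⁺ adm))
∈-enum⁺ {u} {suc r} {i = i} (pick c<u adm) = ∈-++⁺ʳ (map (0 ∷_) (enum u true (suc i) r))
  (∈-cartesianProductWith⁺ _∷_ (∈-applyDownFrom⁺ suc c<u) (∈-enum⁺ adm))

∈-enum⁻ : ∀ {u r b i} {cs : Vec ℕ r} → cs ∈ enum u b i r → Admissible u b i cs
∈-enum⁻ {r = zero} {cs = []} _ = []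
∈-enum⁻ {u} {suc r} {false} {i} cs∈ with _ , cs∈ , refl ← ∈-map⁻ (0 ∷_) cs∈ = skip (∈-enum⁻ cs∈)
∈-enum⁻ {u} {suc r} {true}  {i} cs∈ with ∈-++⁻ (map (0 ∷_) (enum u true (suc i) r)) cs∈
... | inj₁ cs∈ with _ , cs∈ , refl ← ∈-map⁻ (0 ∷_) cs∈ = skip (∈-enum⁻ cs∈)
... | inj₂ cs∈
  with _ , _ , c∈ , cs∈ , refl ← ∈-cartesianProductWith⁻ _∷_ (applyDownFrom suc (u i)) (enum u false (suc i) r) cs∈
  with _ , c<u , refl ← ∈-applyDownFrom⁻ suc c∈ = pick c<u (∈-enum⁻ cs∈)

enum-unique : ∀ u b i r → Unique (enum u b i r)
enum-unique u b     i zero    = [] ∷ []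
enum-unique u false i (suc r) = Unique.map⁺ (proj₂ ∘ ∷-injective) (enum-unique u true (suc i) r)
enum-unique u true  i (suc r) = Unique.++⁺
  (Unique.map⁺ (proj₂ ∘ ∷-injective) (enum-unique u true (suc i) r))
  (Unique.cartesianProductWith⁺ _∷_ ∷-injective
    (Unique.applyDownFrom⁺₁ suc (u i) λ j<i _ → <⇒≢ j<i ∘ sym ∘ suc-injective)
    (enum-unique u false (suc i) r))
  disjoint
  where
  disjoint : ∀ {cs} → ¬ (cs ∈ map (0 ∷_) (enum u true (suc i) r)
               × cs ∈ cartesianProductWith _∷_ (applyDownFrom suc (u i)) (enum u false (suc i) r))
  disjoint (∈₁ , ∈₂)
    with _ , _ , refl ← ∈-map⁻ (0 ∷_) ∈₁
    with _ , _ , c∈ , _ , eq ← ∈-cartesianProductWith⁻ _∷_ (applyDownFrom suc (u i)) (enum u false (suc i) r) ∈₂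
    with _ , _ , refl ← ∈-applyDownFrom⁻ suc c∈ with () ← eq

admissible-bounded : ∀ {u r b i} {cs : Vec ℕ r} → Admissible u b i cs → ∀ p → Vec.lookup cs p ≤ u (i + toℕ p)
admissible-bounded             (skip adm)   zero    = z≤n
admissible-bounded {u} {i = i} (pick c<u _) zero    = subst (_ <_) (cong u (sym (+-identityʳ i))) c<u
admissible-bounded {u} {i = i} (skip adm)   (suc p) =
  subst (_ ≤_) (cong u (sym (+-suc i (toℕ p)))) (admissible-bounded adm p)
admissible-bounded {u} {i = i} (pick _ adm) (suc p) =
  subst (_ ≤_) (cong u (sym (+-suc i (toℕ p)))) (admissible-bounded adm p)

admissible-adjacent : ∀ {u r b i} {cs : Vec ℕ r} → Admissible u b i cs →
                      ∀ p q → toℕ q ≡ suc (toℕ p) → 0 < Vec.lookup cs p → Vec.lookup cs q ≡ 0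
admissible-adjacent (pick _ (skip _)) zero    (suc zero) _  _ = refl
admissible-adjacent (skip adm)        (suc p) (suc q)    eq = admissible-adjacent adm p q (suc-injective eq)
admissible-adjacent (pick _ adm)      (suc p) (suc q)    eq = admissible-adjacent adm p q (suc-injective eq)

-- Bead sets with given runner lengths

module Residues (n : ℕ) .{{_ : NonZero n}} where

  progression : ℕ → ℕ → List ℕ
  progression i c = applyDownFrom (λ j → i + j * n) c

  abacus : ∀ {r} → ℕ → Vec ℕ r → List ℕ
  abacus i []       = []
  abacus i (c ∷ cs) = progression i c ++ abacus (suc i) cs

  ∈-abacus⁻ : ∀ {r} i (cs : Vec ℕ r) {x} → x ∈ abacus i cs →
              ∃₂ λ p j → j < Vec.lookup cs p × x ≡ i + toℕ p + j * n
  ∈-abacus⁻ i (c ∷ cs) x∈ with ∈-++⁻ (progression i c) x∈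
  ... | inj₁ x∈ with j , j<c , refl ← ∈-applyDownFrom⁻ _ x∈ =
    zero , j , j<c , cong (_+ j * n) (sym (+-identityʳ i))
  ... | inj₂ x∈ with p , j , j<c , refl ← ∈-abacus⁻ (suc i) cs x∈ =
    suc p , j , j<c , cong (_+ j * n) (sym (+-suc i (toℕ p)))

  ∈-abacus⁺ : ∀ {r} i (cs : Vec ℕ r) p {j} → j < Vec.lookup cs p → i + toℕ p + j * n ∈ abacus i cs
  ∈-abacus⁺ i (c ∷ cs) zero    {j} j<c = ∈-++⁺ˡ (subst (_∈ progression i c)
    (cong (_+ j * n) (sym (+-identityʳ i))) (∈-applyDownFrom⁺ (λ j → i + j * n) j<c))
  ∈-abacus⁺ i (c ∷ cs) (suc p) {j} j<c = ∈-++⁺ʳ (progression i c) (subst (_∈ abacus (suc i) cs)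
    (cong (_+ j * n) (sym (+-suc i (toℕ p)))) (∈-abacus⁺ (suc i) cs p j<c))

  residue : ∀ {a} → a < n → ∀ j → (a + j * n) % n ≡ a
  residue a<n j = trans ([m+kn]%n≡m%n _ j n) (m<n⇒m%n≡m a<n)

  residue-injective : ∀ {a b} j k → a < n → b < n → a + j * n ≡ b + k * n → a ≡ b × j ≡ k
  residue-injective {a} {b} j k a<n b<n eq = a≡b ,
    *-cancelʳ-≡ j k n (+-cancelˡ-≡ b _ _ (trans (cong (_+ j * n) (sym a≡b)) eq))
    where
    a≡b = trans (sym (residue a<n j)) (trans (cong (_% n) eq) (residue b<n k))

  column< : ∀ {i r} → i + r ≤ n → (p : Fin r) → i + toℕ p < n
  column< {i} i+r≤n p = <-≤-trans (+-monoʳ-< i (toℕ<n p)) i+r≤n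

  ∈-abacus⇒< : ∀ {i r} → i + r ≤ n → (cs : Vec ℕ r) → ∀ p {j} → i + toℕ p + j * n ∈ abacus i cs → j < Vec.lookup cs p
  ∈-abacus⇒< {i} i+r≤n cs p {j} x∈ with q , k , k<c , eq ← ∈-abacus⁻ i cs x∈
    with p≡q , refl ← residue-injective j k (column< i+r≤n p) (column< i+r≤n q) eq
    with refl ← toℕ-injective {i = p} {j = q} (+-cancelˡ-≡ i _ _ p≡q) = k<c

  abacus-injective : ∀ {i r} → i + r ≤ n → {cs ds : Vec ℕ r} → abacus i cs ↭ abacus i ds → cs ≡ ds
  abacus-injective {i} i+r≤n {cs} {ds} perm = lookup-extensional λ p → <-extensional
    (λ j<c → ∈-abacus⇒< i+r≤n ds p (∈-resp-↭ perm (∈-abacus⁺ i cs p j<c)))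
    (λ j<d → ∈-abacus⇒< i+r≤n cs p (∈-resp-↭ (↭-sym perm) (∈-abacus⁺ i ds p j<d)))

  abacus-unique : ∀ {i r} → i + r ≤ n → (cs : Vec ℕ r) → Unique (abacus i cs)
  abacus-unique         _     []       = []
  abacus-unique {i} {suc r} i+r≤n (c ∷ cs) = Unique.++⁺
    (Unique.applyDownFrom⁺₁ _ c λ {j} {k} k<j _ eq → <⇒≢ k<j (*-cancelʳ-≡ k j n (+-cancelˡ-≡ i _ _ (sym eq))))
    (abacus-unique i+r≤n′ cs)
    disjoint
    where
    i+r≤n′ : suc i + r ≤ n
    i+r≤n′ = subst (_≤ n) (+-suc i r) i+r≤n
    disjoint : ∀ {x} → ¬ (x ∈ progression i c × x ∈ abacus (suc i) cs)
    disjoint (∈₁ , ∈₂)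
      with j , _ , refl ← ∈-applyDownFrom⁻ (λ j → i + j * n) ∈₁
      with q , k , _ , eq ← ∈-abacus⁻ (suc i) cs ∈₂ =
      <⇒≢ (m≤m+n (suc i) (toℕ q))
          (proj₁ (residue-injective j k (≤-trans (s≤s (m≤m+n i r)) i+r≤n′) (column< i+r≤n′ q) eq))

  abacus-closed : ∀ {i r} → i + r ≤ n → (cs : Vec ℕ r) → Closed n (abacus i cs)
  abacus-closed {i} i+r≤n cs {y} y+n∈ with ∈-abacus⁻ i cs y+n∈
  ... | p , zero  , _   , eq = contradiction (≤-trans (m≤n+m n y) (≤-reflexive (trans eq (+-identityʳ _))))
                                             (<⇒≱ (column< i+r≤n p))
  ... | p , suc j , j<c , eq = subst (_∈ abacus i cs)
    (+-cancelʳ-≡ n _ _ (trans (rearrange (i + toℕ p) (j * n) n) (sym eq)))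
    (∈-abacus⁺ i cs p (<-trans (n<1+n j) j<c))
    where
    rearrange : ∀ a b c → a + b + c ≡ a + (c + b)
    rearrange = solve-∀

  abacus-pos : ∀ {i r} → 0 < i → (cs : Vec ℕ r) → ∀ {x} → x ∈ abacus i cs → 0 < x
  abacus-pos {i} 0<i cs x∈ with p , j , _ , refl ← ∈-abacus⁻ i cs x∈ =
    ≤-trans 0<i (≤-trans (m≤m+n i (toℕ p)) (m≤m+n _ (j * n)))

  abacus-sparse : ∀ {u b i r} → 0 < i → i + r ≤ n → {cs : Vec ℕ r} → Admissible u b i cs → Sparse (abacus i cs)
  abacus-sparse {i = i} 0<i i+r≤n {cs} adm y∈ sy∈
    with p , j , j<c , refl ← ∈-abacus⁻ i cs y∈
    with q , k , k<c , eq ← ∈-abacus⁻ i cs sy∈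
    with m≤n⇒m<n∨m≡n (column< i+r≤n p)
  ... | inj₁ 1+p<n = contradiction
    (subst (k <_) (admissible-adjacent adm p q q≡1+p (≤-<-trans z≤n j<c)) k<c) λ ()
    where
    q≡1+p : toℕ q ≡ suc (toℕ p)
    q≡1+p = +-cancelˡ-≡ i _ _
      (trans (sym (proj₁ (residue-injective j k 1+p<n (column< i+r≤n q) eq))) (sym (+-suc i (toℕ p))))
  -- The successor of a bead on runner n - 1 has residue 0, and the runners here are numbered from
  -- `i` > 0 on, so nothing wraps around.
  ... | inj₂ 1+p≡n = contradiction (≤-trans 0<i (m≤m+n i (toℕ q)))
    (≤⇒≯ (≤-reflexive (sym (proj₁ (residue-injective (suc j) k (>-nonZero⁻¹ n) (column< i+r≤n q)
      (trans (cong (_+ j * n) (sym 1+p≡n)) eq))))))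

  RunnerLengths : ∀ {r} → List ℕ → ℕ → Vec ℕ r → Set
  RunnerLengths bs i cs = ∀ p j → i + toℕ p + j * n ∈ bs ⇔ j < Vec.lookup cs p

  runnerLengths-∷ : ∀ {r bs i c} {cs : Vec ℕ r} → (∀ j → i + j * n ∈ bs ⇔ j < c) →
                    RunnerLengths bs (suc i) cs → RunnerLengths bs i (c ∷ cs)
  runnerLengths-∷ {bs = bs} {i} {c} first rest zero    j =
    subst (λ k → k + j * n ∈ bs ⇔ j < c) (sym (+-identityʳ i)) (first j)
  runnerLengths-∷ {bs = bs} {i} {cs = cs} first rest (suc p) j =
    subst (λ k → k + j * n ∈ bs ⇔ j < Vec.lookup cs p) (sym (+-suc i (toℕ p))) (rest p j)

  -- On each runner closure under −n makes the beads an initial segment, and sparsity forbids two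
  -- adjacent nonempty runners.
  runners : ∀ {bs} u b i r → Closed n bs → Sparse bs →
            (∀ {k j} → i ≤ k → k < i + r → k + j * n ∈ bs → j < u k) →
            (b ≡ false → i ∉ bs) →
            ∃ λ (cs : Vec ℕ r) → Admissible u b i cs × RunnerLengths bs i cs
  runners      u b i zero    _      _      _     _     = [] , [] , λ ()
  runners {bs} u b i (suc r) closed sparse bound empty = extend b empty
    (initial-segment (u i) (λ j → i + j * n ∈? bs)
      (λ {j} x∈ → closed (subst (_∈ bs) (rearrange i n (j * n)) x∈))
      (bound ≤-refl (m<m+n i z<s)))
    where
    rearrange : ∀ a b c → a + (b + c) ≡ a + c + b
    rearrange = solve-∀

    bound′ : ∀ {k j} → suc i ≤ k → k < suc i + r → k + j * n ∈ bs → j < u k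
    bound′ {k} i<k k< = bound (<⇒≤ i<k) (subst (k <_) (sym (+-suc i r)) k<)

    extend : ∀ b → (b ≡ false → i ∉ bs) →
             (∃ λ c → c ≤ u i × (∀ {j} → i + j * n ∈ bs → j < c) × (∀ {j} → j < c → i + j * n ∈ bs)) →
             ∃ λ (cs : Vec ℕ (suc r)) → Admissible u b i cs × RunnerLengths bs i cs
    extend b _ (zero , _ , to , from) =
      let cs , adm , lengths = runners u true (suc i) r closed sparse bound′ (λ ()) in
      0 ∷ cs , skip adm , runnerLengths-∷ (λ j → mk⇔ to from) lengths
    extend false empty (suc c , _ , _ , from) =
      contradiction (subst (_∈ bs) (+-identityʳ i) (from z<s)) (empty refl)
    -- The runner contains its lowest position `i`, so sparsity excludes `i + 1`; this is the
    -- premise that the state `false` demands.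
    extend true _ (suc c , c<u , to , from) =
      let cs , adm , lengths = runners u false (suc i) r closed sparse bound′
                                 (λ _ → sparse (subst (_∈ bs) (+-identityʳ i) (from z<s))) in
      suc c ∷ cs , pick c<u adm , runnerLengths-∷ (λ j → mk⇔ to from) lengths

-- Cores with distinct parts correspond to admissible runner lengths

module Classification (r : ℕ) where

  n = suc r
  open Residues n

  -- The runners start at 1 because runner 0 is empty. The abacus lists its beads runner by runner,
  -- while `parts` reads them in decreasing order, hence `sort`.
  fromRunners : Vec ℕ r → List ℕ
  fromRunners cs = parts (sort (abacus 1 cs))

  sorted-desc : ∀ cs → Desc (sort (abacus 1 cs))
  sorted-desc cs = sort-desc (abacus-unique ≤-refl cs)

  beads-fromRunners : ∀ cs → beads (fromRunners cs) ↭ abacus 1 cs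
  beads-fromRunners cs = subst (_↭ abacus 1 cs) (sym (beads∘parts (sorted-desc cs))) (sort-↭ _)

  fromRunners-injective : ∀ {cs ds} → fromRunners cs ≡ fromRunners ds → cs ≡ ds
  fromRunners-injective {cs} {ds} eq = abacus-injective ≤-refl
    (↭-trans (↭-sym (beads-fromRunners cs)) (subst (λ λs → beads λs ↭ abacus 1 ds) (sym eq) (beads-fromRunners ds)))

  -- Sorting changes neither the sum nor the number of beads, so the size can be read off the
  -- unsorted abacus, where both are polynomial in the runner lengths.
  size-fromRunners : ∀ cs → size (fromRunners cs) + triangle (length (abacus 1 cs)) ≡ sum (abacus 1 cs)
  size-fromRunners cs = begin
    size λs + triangle (length (abacus 1 cs))  ≡⟨ cong (λ l → size λs + triangle l) length≡ ⟨
    size λs + triangle (length λs)             ≡⟨ sum-beads λs ⟩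
    sum (beads λs)                             ≡⟨ sum-↭ (beads-fromRunners cs) ⟩
    sum (abacus 1 cs)                          ∎
    where
    open ≡-Reasoning
    λs = fromRunners cs
    length≡ : length λs ≡ length (abacus 1 cs)
    length≡ = trans (sym (length-beads λs)) (↭-length (beads-fromRunners cs))

  module _ {t : ℕ} {u : ℕ → ℕ} (0<t : 0 < t)
    (bound⇒ : ∀ {k j} → 0 < k → k < n → k + j * n < t → j < u k)
    (bound⇐ : ∀ {k j} → 0 < k → k < n → j < u k → k + j * n < t)
    (beads<t : ∀ {bs} → All (0 <_) bs → Sparse bs → Closed n bs → Closed t bs → ∀ {x} → x ∈ bs → x < t)
    where

    fromRunners-core : ∀ {cs} → Admissible u true 1 cs → IsSTCoreDistinct n t (fromRunners cs)
    fromRunners-core {cs} adm = distinct , closed⇒core desc (closed ∘ abacus-closed′) , closed⇒core desc t-closed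
      where
      perm = beads-fromRunners cs
      distinct = parts-distinct (sorted-desc cs)
        (All.tabulate (abacus-pos z<s cs ∘ ∈-resp-↭ (sort-↭ _)))
        (λ y∈ sy∈ → abacus-sparse z<s ≤-refl adm (∈-resp-↭ (sort-↭ _) y∈) (∈-resp-↭ (sort-↭ _) sy∈))
      desc : Desc (fromRunners cs)
      desc = Linked⇒AllPairs (flip <-trans) (proj₂ distinct)
      closed : ∀ {y} → y ∈ abacus 1 cs → y ∈ beads (fromRunners cs)
      closed = ∈-resp-↭ (↭-sym perm)
      abacus-closed′ : ∀ {y} → y + n ∈ beads (fromRunners cs) → y ∈ abacus 1 cs
      abacus-closed′ = abacus-closed ≤-refl cs ∘ ∈-resp-↭ perm
      -- Closure under `t` is vacuous, as all beads lie below `t`.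
      t-closed : Closed t (beads (fromRunners cs))
      t-closed {y} y+t∈ with p , j , j<c , eq ← ∈-abacus⁻ 1 cs (∈-resp-↭ perm y+t∈) =
        contradiction (m≤n+m t y) (<⇒≱ (subst (_< t) (sym eq)
          (bound⇐ z<s (column< ≤-refl p) (<-≤-trans j<c (admissible-bounded adm p)))))

    core-fromRunners : ∀ {λs} → IsSTCoreDistinct n t λs → ∃ λ cs → Admissible u true 1 cs × λs ≡ fromRunners cs
    core-fromRunners {λs} ((pos , linked) , n-core , t-core) = cs , adm , (begin
      λs                                ≡⟨ parts∘beads λs ⟨
      parts (beads λs)                  ≡⟨ cong parts (desc-↭⇒≡ (beads-desc desc) (sorted-desc cs)
                                             (↭-trans beads↭ (↭-sym (sort-↭ _)))) ⟩
      parts (sort (abacus 1 cs))        ∎)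
      where
      open ≡-Reasoning
      desc : Desc λs
      desc = Linked⇒AllPairs (flip <-trans) linked
      closed : Closed n (beads λs)
      closed = core⇒closed z<s desc n-core
      small = beads<t (beads-pos pos) (beads-sparse desc) closed (core⇒closed 0<t desc t-core)
      extracted = runners u true 1 r closed (beads-sparse desc) (λ 0<k k<n → bound⇒ 0<k k<n ∘ small) (λ ())
      cs = proj₁ extracted
      adm = proj₁ (proj₂ extracted)
      lengths = proj₂ (proj₂ extracted)

      beads⊆abacus : ∀ {x} → x ∈ beads λs → x ∈ abacus 1 cs
      beads⊆abacus {x} x∈ with x % n | m%n<n x n | m≡m%n+[m/n]*n x n
      ... | zero  | _       | eq = contradiction
        (All.lookup (beads-pos pos) (closed-* closed (x / n) (subst (_∈ beads λs) eq x∈))) λ ()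
      ... | suc k | s≤s k<r | eq = subst (_∈ abacus 1 cs) (sym eq′) (∈-abacus⁺ 1 cs p {x / n}
        (Equivalence.to (lengths p (x / n)) (subst (_∈ beads λs) eq′ x∈)))
        where
        p = Fin.fromℕ< k<r
        eq′ : x ≡ 1 + toℕ p + x / n * n
        eq′ = trans eq (cong (λ k → suc k + x / n * n) (sym (toℕ-fromℕ< k<r)))

      abacus⊆beads : ∀ {x} → x ∈ abacus 1 cs → x ∈ beads λs
      abacus⊆beads x∈ with p , j , j<c , refl ← ∈-abacus⁻ 1 cs x∈ = Equivalence.from (lengths p j) j<c

      beads↭ : beads λs ↭ abacus 1 cs
      beads↭ = unique-⇔⇒↭ (desc⇒unique (beads-desc desc)) (abacus-unique ≤-refl cs) (mk⇔ beads⊆abacus abacus⊆beads)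

    -- An arbitrary enumeration is known only through its members. Without duplicates, equal members
    -- mean a permutation, and moments do not see the order.
    enumeration-↭ : ∀ {L} → Enumerates n t L → L ↭ map fromRunners (enum u true 1 r)
    enumeration-↭ {L} (L! , L⇔) = unique-⇔⇒↭ L! (Unique.map⁺ fromRunners-injective (enum-unique u true 1 r)) (mk⇔ to from)
      where
      to : ∀ {λs} → λs ∈ L → λs ∈ map fromRunners (enum u true 1 r)
      to λs∈ with cs , adm , refl ← core-fromRunners (Equivalence.to (L⇔ _) λs∈) = ∈-map⁺ fromRunners (∈-enum⁺ adm)
      from : ∀ {λs} → λs ∈ map fromRunners (enum u true 1 r) → λs ∈ L
      from λs∈ with cs , cs∈ , refl ← ∈-map⁻ fromRunners λs∈ = Equivalence.from (L⇔ _) (fromRunners-core (∈-enum⁻ cs∈))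

-- Asymptotics

-- For a variable `m` the normalisation inside `_/ℚ_` is stuck on a gcd; in the explicit normal form
-- the operations and the order of ℚ reduce.
ℕtoℚ≡mkℚ : ∀ m → ℕtoℚ m ≡ mkℚ (ℤ.+ m) 0 (Coprimality.sym (Coprimality.1-coprimeTo m))
ℕtoℚ≡mkℚ m = ℚ.normalize-coprime (Coprimality.sym (Coprimality.1-coprimeTo m))

ℕtoℚ-+ : ∀ m n → ℕtoℚ (m + n) ≡ ℕtoℚ m +ℚ ℕtoℚ n
ℕtoℚ-+ m n = sym (trans (cong₂ _+ℚ_ (ℕtoℚ≡mkℚ m) (ℕtoℚ≡mkℚ n))
  (cong (_/ℚ 1) (cong₂ ℤ._+_ (ℤ.*-identityʳ (ℤ.+ m)) (ℤ.*-identityʳ (ℤ.+ n)))))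

ℕtoℚ-* : ∀ m n → ℕtoℚ (m * n) ≡ ℕtoℚ m *ℚ ℕtoℚ n
ℕtoℚ-* m n = sym (trans (cong₂ _*ℚ_ (ℕtoℚ≡mkℚ m) (ℕtoℚ≡mkℚ n))
  (cong (_/ℚ 1) (sym (ℤ.pos-* m n))))

ℕtoℚ-mono : ∀ {m n} → m ≤ n → ℕtoℚ m ≤ℚ ℕtoℚ n
ℕtoℚ-mono {m} {n} m≤n = subst₂ _≤ℚ_ (sym (ℕtoℚ≡mkℚ m)) (sym (ℕtoℚ≡mkℚ n))
  (*≤* (ℤ.*-monoʳ-≤-nonNeg (ℤ.+ 1) (ℤ.+≤+ m≤n)))

ℕtoℚ-nonNeg : ∀ m → NonNegative (ℕtoℚ m)
ℕtoℚ-nonNeg m = ℚ.normalize-nonNeg m 1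

0≤ℕtoℚ : ∀ m → 0ℚ ≤ℚ ℕtoℚ m
0≤ℕtoℚ m = ℚ.nonNegative⁻¹ (ℕtoℚ m) {{ℕtoℚ-nonNeg m}}

ℕtoℚ-pos : ∀ m .{{_ : NonZero m}} → Positive (ℕtoℚ m)
ℕtoℚ-pos m = ℚ.normalize-pos m 1

/-*-cancel : ∀ m l → (ℤ.+ m /ℚ suc l) *ℚ ℕtoℚ (suc l) ≡ ℕtoℚ m
/-*-cancel m l = ℚ.toℚᵘ-injective (begin
  toℚᵘ ((ℤ.+ m /ℚ suc l) *ℚ ℕtoℚ (suc l))             ≈⟨ ℚ.toℚᵘ-homo-* (ℤ.+ m /ℚ suc l) (ℕtoℚ (suc l)) ⟩
  toℚᵘ (ℤ.+ m /ℚ suc l) ℚᵘ.* toℚᵘ (ℕtoℚ (suc l))      ≈⟨ ℚᵘ.*-cong (ℚ.toℚᵘ-fromℚᵘ (mkℚᵘ (ℤ.+ m) l))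
                                                                    (ℚ.toℚᵘ-fromℚᵘ (mkℚᵘ (ℤ.+ suc l) 0)) ⟩
  mkℚᵘ (ℤ.+ m) l ℚᵘ.* mkℚᵘ (ℤ.+ suc l) 0               ≈⟨ *≡* (ℤ.*-assoc (ℤ.+ m) (ℤ.+ suc l) (ℤ.+ 1)) ⟩
  mkℚᵘ (ℤ.+ m) 0                                     ≈⟨ ℚ.toℚᵘ-fromℚᵘ (mkℚᵘ (ℤ.+ m) 0) ⟨
  toℚᵘ (ℕtoℚ m)                                    ∎)
  where open ℚᵘ.≃-Reasoning

*-nonNeg : ∀ {p q} → 0ℚ ≤ℚ p → 0ℚ ≤ℚ q → 0ℚ ≤ℚ p *ℚ q
*-nonNeg {p} {q} 0≤p 0≤q =
  ℚ.nonNegative⁻¹ (p *ℚ q) {{ℚ.nonNeg*nonNeg⇒nonNeg p {{nonNegative 0≤p}} q {{nonNegative 0≤q}}}}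

*-pos : ∀ {p q} → 0ℚ <ℚ p → 0ℚ <ℚ q → 0ℚ <ℚ p *ℚ q
*-pos {p} {q} 0<p 0<q = ℚ.positive⁻¹ (p *ℚ q) {{ℚ.pos*pos⇒pos p {{positive 0<p}} q {{positive 0<q}}}}

*-mono-≤-nonNeg : ∀ {p q r s} → 0ℚ ≤ℚ q → 0ℚ ≤ℚ r → p ≤ℚ q → r ≤ℚ s → p *ℚ r ≤ℚ q *ℚ s
*-mono-≤-nonNeg {p} {q} {r} {s} 0≤q 0≤r p≤q r≤s = ℚ.≤-trans
  (ℚ.*-monoʳ-≤-nonNeg r {{nonNegative 0≤r}} p≤q) (ℚ.*-monoˡ-≤-nonNeg q {{nonNegative 0≤q}} r≤s)

∣p-q∣≤ : ∀ {p q r} → p ≤ℚ q +ℚ r → q ≤ℚ p +ℚ r → ∣ p - q ∣ ≤ℚ r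
∣p-q∣≤ {p} {q} {r} p≤ q≤ with ℚ.∣p∣≡p∨∣p∣≡-p (p - q)
... | inj₁ eq = subst₂ _≤ℚ_ (sym eq) (solve 2 (λ q r → (q :+ r) :- q := r) refl q r) (ℚ.+-monoˡ-≤ (-ℚ q) p≤)
... | inj₂ eq = subst₂ _≤ℚ_ (sym (trans eq (solve 2 (λ p q → :- (p :- q) := q :- p) refl p q)))
  (solve 2 (λ p r → (p :+ r) :- p := r) refl p r) (ℚ.+-monoˡ-≤ (-ℚ p) q≤)

-- f d = a dᵐ + O(dᵐ⁻¹), multiplied by d so that m = 0 needs no truncated subtraction.
record Asymptotic (m : ℕ) (a : ℚ) (f : ℕ → ℚ) : Set where
  constructor _,_
  field
    constant : ℚ
    bound    : ∀ d → 1 ≤ d → ∣ f d - a *ℚ ℕtoℚ (d ^ m) ∣ *ℚ ℕtoℚ d ≤ℚ constant *ℚ ℕtoℚ (d ^ m)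

error-nonNeg : ∀ p d {x} → ∣ p ∣ *ℚ ℕtoℚ d ≤ℚ x → 0ℚ ≤ℚ x
error-nonNeg p d bound = ℚ.≤-trans
  (ℚ.≤-trans (ℚ.≤-reflexive (sym (ℚ.*-zeroˡ (ℕtoℚ d)))) (ℚ.*-monoʳ-≤-nonNeg (ℕtoℚ d) {{ℕtoℚ-nonNeg d}} (ℚ.0≤∣p∣ p))) bound

p≤p*d : ∀ {p} d → 0ℚ ≤ℚ p → 1 ≤ d → p ≤ℚ p *ℚ ℕtoℚ d
p≤p*d {p} d 0≤p 1≤d = ℚ.≤-trans (ℚ.≤-reflexive (sym (ℚ.*-identityʳ p)))
  (ℚ.*-monoˡ-≤-nonNeg p {{nonNegative 0≤p}} (ℕtoℚ-mono 1≤d))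

module _ where
  open ℚ.≤-Reasoning

  asymptotic-cong : ∀ {m a f g} → (∀ d → 1 ≤ d → f d ≡ g d) → Asymptotic m a f → Asymptotic m a g
  asymptotic-cong {m} {a} f≗g (M , bound) = M , λ d 1≤d →
    subst (λ x → ∣ x - a *ℚ ℕtoℚ (d ^ m) ∣ *ℚ ℕtoℚ d ≤ℚ M *ℚ ℕtoℚ (d ^ m)) (f≗g d 1≤d) (bound d 1≤d)

  asymptotic-const : ∀ q → Asymptotic 0 q (λ _ → q)
  asymptotic-const q = 0ℚ , λ d _ → ℚ.≤-reflexive (begin-equality
    ∣ q - q *ℚ 1ℚ ∣ *ℚ ℕtoℚ d  ≡⟨ cong (λ x → ∣ x ∣ *ℚ ℕtoℚ d) (solve 1 (λ q → q :- q :* con 1ℚ := con 0ℚ) refl q) ⟩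
    0ℚ *ℚ ℕtoℚ d               ≡⟨ ℚ.*-zeroˡ (ℕtoℚ d) ⟩
    0ℚ                         ∎)

  asymptotic-0 : ∀ m → Asymptotic m 0ℚ (λ _ → 0ℚ)
  asymptotic-0 m = 0ℚ , λ d _ → ℚ.≤-reflexive (begin-equality
    ∣ 0ℚ - 0ℚ *ℚ ℕtoℚ (d ^ m) ∣ *ℚ ℕtoℚ d
      ≡⟨ cong (λ x → ∣ x ∣ *ℚ ℕtoℚ d) (solve 1 (λ x → con 0ℚ :- con 0ℚ :* x := con 0ℚ) refl (ℕtoℚ (d ^ m))) ⟩
    0ℚ *ℚ ℕtoℚ d         ≡⟨ ℚ.*-zeroˡ (ℕtoℚ d) ⟩
    0ℚ                   ≡⟨ ℚ.*-zeroˡ (ℕtoℚ (d ^ m)) ⟨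
    0ℚ *ℚ ℕtoℚ (d ^ m)   ∎)

  asymptotic-+ : ∀ {m a b f g} → Asymptotic m a f → Asymptotic m b g →
                 Asymptotic m (a +ℚ b) (λ d → f d +ℚ g d)
  asymptotic-+ {m} {a} {b} {f} {g} (M , boundᶠ) (N , boundᵍ) = M +ℚ N , λ d 1≤d →
    let D = ℕtoℚ (d ^ m); x = ℕtoℚ d; F = f d; G = g d in begin
    ∣ (F +ℚ G) - (a +ℚ b) *ℚ D ∣ *ℚ x
      ≡⟨ cong (λ y → ∣ y ∣ *ℚ x) (solve 5 (λ F G a b D → (F :+ G) :- (a :+ b) :* D := (F :- a :* D) :+ (G :- b :* D)) refl F G a b D) ⟩
    ∣ (F - a *ℚ D) +ℚ (G - b *ℚ D) ∣ *ℚ x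
      ≤⟨ ℚ.*-monoʳ-≤-nonNeg x {{ℕtoℚ-nonNeg d}} (ℚ.∣p+q∣≤∣p∣+∣q∣ (F - a *ℚ D) (G - b *ℚ D)) ⟩
    (∣ F - a *ℚ D ∣ +ℚ ∣ G - b *ℚ D ∣) *ℚ x
      ≡⟨ ℚ.*-distribʳ-+ x ∣ F - a *ℚ D ∣ ∣ G - b *ℚ D ∣ ⟩
    ∣ F - a *ℚ D ∣ *ℚ x +ℚ ∣ G - b *ℚ D ∣ *ℚ x
      ≤⟨ ℚ.+-mono-≤ (boundᶠ d 1≤d) (boundᵍ d 1≤d) ⟩
    M *ℚ D +ℚ N *ℚ D
      ≡⟨ ℚ.*-distribʳ-+ D M N ⟨
    (M +ℚ N) *ℚ D ∎

  ∣p∣≤∣p-q∣+∣q∣ : ∀ p q → ∣ p ∣ ≤ℚ ∣ p - q ∣ +ℚ ∣ q ∣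
  ∣p∣≤∣p-q∣+∣q∣ p q = begin
    ∣ p ∣                ≡⟨ cong ∣_∣ (solve 2 (λ p q → p := (p :- q) :+ q) refl p q) ⟩
    ∣ (p - q) +ℚ q ∣     ≤⟨ ℚ.∣p+q∣≤∣p∣+∣q∣ (p - q) q ⟩
    ∣ p - q ∣ +ℚ ∣ q ∣   ∎

  ∣a*D∣ : ∀ a m → ∣ a *ℚ ℕtoℚ m ∣ ≡ ∣ a ∣ *ℚ ℕtoℚ m
  ∣a*D∣ a m = trans (ℚ.∣p*q∣≡∣p∣*∣q∣ a (ℕtoℚ m))
    (cong (∣ a ∣ *ℚ_) (ℚ.0≤p⇒∣p∣≡p (0≤ℕtoℚ m)))

  asymptotic-* : ∀ {m n a b f g} → Asymptotic m a f → Asymptotic n b g →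
                 Asymptotic (m + n) (a *ℚ b) (λ d → f d *ℚ g d)
  asymptotic-* {m} {n} {a} {b} {f} {g} (M , boundᶠ) (N , boundᵍ) =
    M *ℚ (N +ℚ ∣ b ∣) +ℚ ∣ a ∣ *ℚ N , λ d 1≤d →
    let D = ℕtoℚ (d ^ m); E = ℕtoℚ (d ^ n); x = ℕtoℚ d; F = f d; G = g d
        δ = ∣ F - a *ℚ D ∣; ε = ∣ G - b *ℚ E ∣
        DE = trans (cong ℕtoℚ (^-distribˡ-+-* d m n)) (ℕtoℚ-* (d ^ m) (d ^ n))
        -- Here 1 ≤ d serves to discard the factor `d` in the error of `g`, so that G = O(E). The
        -- product error is then split into two terms, each with one small factor.
        ∣G∣≤ : ∣ G ∣ ≤ℚ N *ℚ E +ℚ ∣ b ∣ *ℚ E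
        ∣G∣≤ = ℚ.≤-trans (∣p∣≤∣p-q∣+∣q∣ G (b *ℚ E)) (ℚ.+-mono-≤
          (ℚ.≤-trans (p≤p*d d (ℚ.0≤∣p∣ (G - b *ℚ E)) 1≤d) (boundᵍ d 1≤d)) (ℚ.≤-reflexive (∣a*D∣ b (d ^ n))))
    in begin
    ∣ F *ℚ G - a *ℚ b *ℚ ℕtoℚ (d ^ (m + n)) ∣ *ℚ x
      ≡⟨ cong (λ y → ∣ F *ℚ G - a *ℚ b *ℚ y ∣ *ℚ x) DE ⟩
    ∣ F *ℚ G - a *ℚ b *ℚ (D *ℚ E) ∣ *ℚ x
      ≡⟨ cong (λ y → ∣ y ∣ *ℚ x) (solve 6 (λ F G a b D E →
           F :* G :- a :* b :* (D :* E) := (F :- a :* D) :* G :+ a :* D :* (G :- b :* E)) refl F G a b D E) ⟩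
    ∣ (F - a *ℚ D) *ℚ G +ℚ a *ℚ D *ℚ (G - b *ℚ E) ∣ *ℚ x
      ≤⟨ ℚ.*-monoʳ-≤-nonNeg x {{ℕtoℚ-nonNeg d}} (ℚ.∣p+q∣≤∣p∣+∣q∣ ((F - a *ℚ D) *ℚ G) (a *ℚ D *ℚ (G - b *ℚ E))) ⟩
    (∣ (F - a *ℚ D) *ℚ G ∣ +ℚ ∣ a *ℚ D *ℚ (G - b *ℚ E) ∣) *ℚ x
      ≡⟨ cong (_*ℚ x) (cong₂ _+ℚ_ (ℚ.∣p*q∣≡∣p∣*∣q∣ (F - a *ℚ D) G)
           (trans (ℚ.∣p*q∣≡∣p∣*∣q∣ (a *ℚ D) (G - b *ℚ E)) (cong (_*ℚ ε) (∣a*D∣ a (d ^ m))))) ⟩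
    (δ *ℚ ∣ G ∣ +ℚ ∣ a ∣ *ℚ D *ℚ ε) *ℚ x
      ≡⟨ solve 6 (λ δ G a D ε x → (δ :* G :+ a :* D :* ε) :* x := δ :* x :* G :+ a :* D :* (ε :* x)) refl
           δ ∣ G ∣ ∣ a ∣ D ε x ⟩
    δ *ℚ x *ℚ ∣ G ∣ +ℚ ∣ a ∣ *ℚ D *ℚ (ε *ℚ x)
      ≤⟨ ℚ.+-mono-≤
           (*-mono-≤-nonNeg (error-nonNeg (F - a *ℚ D) d (boundᶠ d 1≤d)) (ℚ.0≤∣p∣ G) (boundᶠ d 1≤d) ∣G∣≤)
           (ℚ.*-monoˡ-≤-nonNeg (∣ a ∣ *ℚ D) {{ℚ.nonNeg*nonNeg⇒nonNeg ∣ a ∣ {{ℚ.∣-∣-nonNeg a}} D {{ℕtoℚ-nonNeg (d ^ m)}}}} (boundᵍ d 1≤d)) ⟩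
    M *ℚ D *ℚ (N *ℚ E +ℚ ∣ b ∣ *ℚ E) +ℚ ∣ a ∣ *ℚ D *ℚ (N *ℚ E)
      ≡⟨ solve 6 (λ M N a b D E → M :* D :* (N :* E :+ b :* E) :+ a :* D :* (N :* E)
                    := (M :* (N :+ b) :+ a :* N) :* (D :* E)) refl M N ∣ a ∣ ∣ b ∣ D E ⟩
    (M *ℚ (N +ℚ ∣ b ∣) +ℚ ∣ a ∣ *ℚ N) *ℚ (D *ℚ E)
      ≡⟨ cong ((M *ℚ (N +ℚ ∣ b ∣) +ℚ ∣ a ∣ *ℚ N) *ℚ_) DE ⟨
    (M *ℚ (N +ℚ ∣ b ∣) +ℚ ∣ a ∣ *ℚ N) *ℚ ℕtoℚ (d ^ (m + n)) ∎

  -- Measured one order higher, the term a dᵐ is part of the error, whatever `a` is. This brings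
  -- summands of different degrees to a common one.
  asymptotic-suc : ∀ {m a f} → Asymptotic m a f → Asymptotic (suc m) 0ℚ f
  asymptotic-suc {m} {a} {f} (M , bound) = M +ℚ ∣ a ∣ , λ d 1≤d →
    let D = ℕtoℚ (d ^ m); D′ = ℕtoℚ (d ^ suc m); x = ℕtoℚ d; F = f d in begin
    ∣ F - 0ℚ *ℚ D′ ∣ *ℚ x
      ≡⟨ cong (λ y → ∣ y ∣ *ℚ x) (solve 2 (λ F D → F :- con 0ℚ :* D := F) refl F D′) ⟩
    ∣ F ∣ *ℚ x
      ≤⟨ ℚ.*-monoʳ-≤-nonNeg x {{ℕtoℚ-nonNeg d}} (∣p∣≤∣p-q∣+∣q∣ F (a *ℚ D)) ⟩
    (∣ F - a *ℚ D ∣ +ℚ ∣ a *ℚ D ∣) *ℚ x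
      ≡⟨ cong (λ y → (∣ F - a *ℚ D ∣ +ℚ y) *ℚ x) (∣a*D∣ a (d ^ m)) ⟩
    (∣ F - a *ℚ D ∣ +ℚ ∣ a ∣ *ℚ D) *ℚ x
      ≡⟨ ℚ.*-distribʳ-+ x ∣ F - a *ℚ D ∣ (∣ a ∣ *ℚ D) ⟩
    ∣ F - a *ℚ D ∣ *ℚ x +ℚ ∣ a ∣ *ℚ D *ℚ x
      ≤⟨ ℚ.+-monoˡ-≤ (∣ a ∣ *ℚ D *ℚ x) (ℚ.≤-trans (bound d 1≤d) (p≤p*d d (error-nonNeg (F - a *ℚ D) d (bound d 1≤d)) 1≤d)) ⟩
    M *ℚ D *ℚ x +ℚ ∣ a ∣ *ℚ D *ℚ x
      ≡⟨ solve 4 (λ M a D x → M :* D :* x :+ a :* D :* x := (M :+ a) :* (x :* D)) refl M ∣ a ∣ D x ⟩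
    (M +ℚ ∣ a ∣) *ℚ (x *ℚ D)
      ≡⟨ cong ((M +ℚ ∣ a ∣) *ℚ_) (ℕtoℚ-* d (d ^ m)) ⟨
    (M +ℚ ∣ a ∣) *ℚ D′ ∎

asymptotic-≤ : ∀ {m n a f} → m ≤ n → 0ℚ ≤ℚ a → Asymptotic m a f →
               ∃ λ b → 0ℚ ≤ℚ b × Asymptotic n b f
asymptotic-≤ {m} {n} {a} {f} m≤n 0≤a A = go (≤⇒≤′ m≤n)
  where
  go : ∀ {n} → m ≤′ n → ∃ λ b → 0ℚ ≤ℚ b × Asymptotic n b f
  go ≤′-refl       = a , 0≤a , A
  go (≤′-step m≤n) = 0ℚ , ℚ.≤-refl , asymptotic-suc (proj₂ (proj₂ (go m≤n)))

-- Sums of monomials and polynomials over the enumerated vectors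

powerSum : ℕ → ℕ → ℕ
powerSum e u = sum (map (_^ e) (applyDownFrom suc u))

-- With `^-suc-upper` this is a discrete mean value theorem for xᵉ⁺¹. Telescoping the two yields the
-- leading term of the power sums without their exact formula.
^-suc-lower : ∀ e x → x ^ suc e + suc e * x ^ e ≤ suc x ^ suc e
^-suc-lower zero    x = ≤-reflexive (lemma x)
  where
  lemma : ∀ x → x * 1 + 1 ≡ suc x * 1
  lemma = solve-∀
^-suc-lower (suc e) x = begin
  x * (x * y) + (2 + e) * (x * y)                ≤⟨ m≤m+n _ (suc e * y) ⟩
  x * (x * y) + (2 + e) * (x * y) + suc e * y    ≡⟨ lemma x y e ⟩
  suc x * (x * y + suc e * y)                    ≤⟨ *-monoʳ-≤ (suc x) (^-suc-lower e x) ⟩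
  suc x * suc x ^ suc e                          ∎
  where
  open ≤-Reasoning
  y = x ^ e
  lemma : ∀ x y e → x * (x * y) + (2 + e) * (x * y) + suc e * y ≡ suc x * (x * y + suc e * y)
  lemma = solve-∀

^-suc-upper : ∀ e x → suc x ^ suc e ≤ x ^ suc e + suc e * suc x ^ e
^-suc-upper zero    x = ≤-reflexive (lemma x)
  where
  lemma : ∀ x → suc x * 1 ≡ x * 1 + 1
  lemma = solve-∀
^-suc-upper (suc e) x = begin
  suc x * z                                      ≡⟨⟩
  z + x * z                                      ≤⟨ +-monoʳ-≤ z (*-monoʳ-≤ x (^-suc-upper e x)) ⟩
  z + x * (x ^ suc e + suc e * suc x ^ e)        ≤⟨ m≤m+n _ (suc e * suc x ^ e) ⟩
  z + x * (x ^ suc e + suc e * suc x ^ e) + suc e * suc x ^ e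
    ≡⟨ lemma x (x ^ suc e) e (suc x ^ e) ⟩
  x * x ^ suc e + (2 + e) * z                    ∎
  where
  open ≤-Reasoning
  z = suc x ^ suc e
  lemma : ∀ x y e w → suc x * w + x * (y + suc e * w) + suc e * w ≡ x * y + (2 + e) * (suc x * w)
  lemma = solve-∀

powerSum-lower : ∀ e d → d ^ suc e ≤ suc e * powerSum e d
powerSum-lower e zero    = z≤n
powerSum-lower e (suc d) = begin
  suc d ^ suc e                               ≤⟨ ^-suc-upper e d ⟩
  d ^ suc e + suc e * suc d ^ e               ≤⟨ +-monoˡ-≤ _ (powerSum-lower e d) ⟩
  suc e * powerSum e d + suc e * suc d ^ e    ≡⟨ lemma (suc e) (powerSum e d) (suc d ^ e) ⟩
  suc e * powerSum e (suc d)                  ∎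
  where
  open ≤-Reasoning
  lemma : ∀ a b c → a * b + a * c ≡ a * (c + b)
  lemma = solve-∀

powerSum-upper : ∀ e d → suc e * powerSum e d ≤ d ^ suc e + suc e * d ^ e
powerSum-upper e zero    = ≤-trans (≤-reflexive (*-zeroʳ (suc e))) z≤n
powerSum-upper e (suc d) = begin
  suc e * powerSum e (suc d)                  ≡⟨ *-distribˡ-+ (suc e) (suc d ^ e) (powerSum e d) ⟩
  suc e * suc d ^ e + suc e * powerSum e d    ≤⟨ +-monoʳ-≤ (suc e * suc d ^ e) (powerSum-upper e d) ⟩
  suc e * suc d ^ e + (d ^ suc e + suc e * d ^ e)
                                              ≤⟨ +-monoʳ-≤ (suc e * suc d ^ e) (^-suc-lower e d) ⟩
  suc e * suc d ^ e + suc d ^ suc e           ≡⟨ +-comm (suc e * suc d ^ e) _ ⟩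
  suc d ^ suc e + suc e * suc d ^ e           ∎
  where open ≤-Reasoning

powerSum-mono : ∀ e {u v} → u ≤ v → powerSum e u ≤ powerSum e v
powerSum-mono e {u} u≤v = go (≤⇒≤′ u≤v)
  where
  go : ∀ {v} → u ≤′ v → powerSum e u ≤ powerSum e v
  go ≤′-refl                 = ≤-refl
  go {suc v} (≤′-step u≤v) = ≤-trans (go u≤v) (m≤n+m _ (suc v ^ e))

module _ {u : ℕ → ℕ} (u≤d : ∀ d → 1 ≤ d → u d ≤ d) (d≤1+u : ∀ d → 1 ≤ d → d ≤ suc (u d)) where

  -- Capacities d and d - 1 are treated together: losing the summand c = d costs (e + 1) dᵉ, the
  -- same error that `powerSum-upper` already allows.
  powerSum≈ : ∀ e d → 1 ≤ d → suc e * powerSum e (u d) ≤ d ^ suc e + suc e * d ^ e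
                            × d ^ suc e ≤ suc e * powerSum e (u d) + suc e * d ^ e
  powerSum≈ e d 1≤d = upper , lower d 1≤d
    where
    open ≤-Reasoning
    upper : suc e * powerSum e (u d) ≤ d ^ suc e + suc e * d ^ e
    upper = ≤-trans (*-monoʳ-≤ (suc e) (powerSum-mono e (u≤d d 1≤d))) (powerSum-upper e d)

    lower : ∀ d → 1 ≤ d → d ^ suc e ≤ suc e * powerSum e (u d) + suc e * d ^ e
    lower (suc d) 1≤d = begin
      suc d ^ suc e                                   ≤⟨ powerSum-lower e (suc d) ⟩
      suc e * (suc d ^ e + powerSum e d)              ≤⟨ *-monoʳ-≤ (suc e) (+-monoʳ-≤ (suc d ^ e)
                                                           (powerSum-mono e (s≤s⁻¹ (d≤1+u (suc d) 1≤d)))) ⟩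
      suc e * (suc d ^ e + powerSum e (u (suc d)))    ≡⟨ lemma (suc e) (suc d ^ e) _ ⟩
      suc e * powerSum e (u (suc d)) + suc e * suc d ^ e ∎
      where
      lemma : ∀ a b c → a * (b + c) ≡ a * c + a * b
      lemma = solve-∀

  powerSum-asymptotic : ∀ e → Asymptotic (suc e) (ℤ.+ 1 /ℚ suc e) (λ d → ℕtoℚ (powerSum e (u d)))
  -- Dividing both inequalities of `powerSum≈` by e + 1 leaves the error dᵉ, and dᵉ · d = dᵉ⁺¹, so
  -- the constant is 1.
  powerSum-asymptotic e = 1ℚ , λ d 1≤d →
    let S = ℕtoℚ (powerSum e (u d)); D = ℕtoℚ (d ^ e); D′ = ℕtoℚ (d ^ suc e)
        upper , lower = powerSum≈ e d 1≤d in begin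
    ∣ S - q *ℚ D′ ∣ *ℚ ℕtoℚ d
      ≤⟨ ℚ.*-monoʳ-≤-nonNeg (ℕtoℚ d) {{ℕtoℚ-nonNeg d}} (∣p-q∣≤ {S} {q *ℚ D′}
           (subst₂ _≤ℚ_ (cancel (powerSum e (u d)))
             (trans (scaled-+ (d ^ suc e) _) (cong (q *ℚ D′ +ℚ_) (cancel (d ^ e)))) (scaled upper))
           (subst (q *ℚ D′ ≤ℚ_) (trans (scaled-+ (suc e * powerSum e (u d)) _)
             (cong₂ _+ℚ_ (cancel (powerSum e (u d))) (cancel (d ^ e)))) (scaled lower))) ⟩
    D *ℚ ℕtoℚ d       ≡⟨ ℚ.*-comm D (ℕtoℚ d) ⟩
    ℕtoℚ d *ℚ D       ≡⟨ ℕtoℚ-* d (d ^ e) ⟨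
    D′                ≡⟨ ℚ.*-identityˡ D′ ⟨
    1ℚ *ℚ D′          ∎
    where
    open ℚ.≤-Reasoning
    q = ℤ.+ 1 /ℚ suc e
    scaled : ∀ {m n} → m ≤ n → q *ℚ ℕtoℚ m ≤ℚ q *ℚ ℕtoℚ n
    scaled m≤n = ℚ.*-monoˡ-≤-nonNeg q {{ℚ.normalize-nonNeg 1 (suc e)}} (ℕtoℚ-mono m≤n)
    scaled-+ : ∀ m n → q *ℚ ℕtoℚ (m + n) ≡ q *ℚ ℕtoℚ m +ℚ q *ℚ ℕtoℚ n
    scaled-+ m n = trans (cong (q *ℚ_) (ℕtoℚ-+ m n)) (ℚ.*-distribˡ-+ q (ℕtoℚ m) (ℕtoℚ n))
    cancel : ∀ m → q *ℚ ℕtoℚ (suc e * m) ≡ ℕtoℚ m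
    cancel m = trans (cong (q *ℚ_) (ℕtoℚ-* (suc e) m)) (trans (sym (ℚ.*-assoc q (ℕtoℚ (suc e)) (ℕtoℚ m)))
      (trans (cong (_*ℚ ℕtoℚ m) (/-*-cancel 1 e)) (ℚ.*-identityˡ (ℕtoℚ m))))

monomial : ∀ {r} → Vec ℕ r → Vec ℕ r → ℕ
monomial []       []       = 1
monomial (e ∷ es) (c ∷ cs) = c ^ e * monomial es cs

sum-map-* : ∀ {A : Set} k (f : A → ℕ) xs → sum (map (λ x → k * f x) xs) ≡ k * sum (map f xs)
sum-map-* k f []       = sym (*-zeroʳ k)
sum-map-* k f (x ∷ xs) = trans (cong (k * f x +_) (sum-map-* k f xs)) (sym (*-distribˡ-+ k (f x) _))

momentSum : (ℕ → ℕ) → Bool → ℕ → ∀ {r} → Vec ℕ r → ℕ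
momentSum u b i {r} es = sum (map (monomial es) (enum u b i r))

momentSum-skip : ∀ {r} e (es : Vec ℕ r) xs →
                 sum (map (monomial (e ∷ es)) (map (0 ∷_) xs)) ≡ 0 ^ e * sum (map (monomial es) xs)
momentSum-skip e es xs = trans (cong sum (sym (map-∘ {g = monomial (e ∷ es)} {f = 0 ∷_} xs)))
  (sum-map-* (0 ^ e) (monomial es) xs)

momentSum-product : ∀ {r} e (es : Vec ℕ r) cs xs →
  sum (map (monomial (e ∷ es)) (cartesianProductWith _∷_ cs xs)) ≡ sum (map (_^ e) cs) * sum (map (monomial es) xs)
momentSum-product e es []       xs = refl
momentSum-product e es (c ∷ cs) xs = begin
  sum (map f (map (c ∷_) xs ++ rest))              ≡⟨ cong sum (map-++ f (map (c ∷_) xs) rest) ⟩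
  sum (map f (map (c ∷_) xs) ++ map f rest)        ≡⟨ sum-++ (map f (map (c ∷_) xs)) (map f rest) ⟩
  sum (map f (map (c ∷_) xs)) + sum (map f rest)
    ≡⟨ cong₂ _+_ (trans (cong sum (sym (map-∘ {g = f} {f = c ∷_} xs))) (sum-map-* (c ^ e) (monomial es) xs))
                 (momentSum-product e es cs xs) ⟩
  c ^ e * S + sum (map (_^ e) cs) * S              ≡⟨ *-distribʳ-+ S (c ^ e) _ ⟨
  (c ^ e + sum (map (_^ e) cs)) * S                ∎
  where
  open ≡-Reasoning
  f    = monomial (e ∷ es)
  rest = cartesianProductWith _∷_ cs xs
  S    = sum (map (monomial es) xs)

momentSum-true : ∀ u i {r} e (es : Vec ℕ r) → momentSum u true i (e ∷ es) ≡
  0 ^ e * momentSum u true (suc i) es + powerSum e (u i) * momentSum u false (suc i) es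
momentSum-true u i {r} e es = begin
  sum (map f (map (0 ∷_) xs ++ ys))                ≡⟨ cong sum (map-++ f (map (0 ∷_) xs) ys) ⟩
  sum (map f (map (0 ∷_) xs) ++ map f ys)          ≡⟨ sum-++ (map f (map (0 ∷_) xs)) (map f ys) ⟩
  sum (map f (map (0 ∷_) xs)) + sum (map f ys)
    ≡⟨ cong₂ _+_ (momentSum-skip e es xs)
                 (momentSum-product e es (applyDownFrom suc (u i)) (enum u false (suc i) r)) ⟩
  0 ^ e * momentSum u true (suc i) es + powerSum e (u i) * momentSum u false (suc i) es ∎
  where
  open ≡-Reasoning
  f  = monomial (e ∷ es)
  xs = enum u true (suc i) r
  ys = cartesianProductWith _∷_ (applyDownFrom suc (u i)) (enum u false (suc i) r)

-- The maximal number of nonzero entries of a vector in enum u b i r.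
rank : Bool → ℕ → ℕ
rank true  r = ⌊ suc r /2⌋
rank false r = ⌊ r /2⌋

-- Polynomial functions of total degree at most `m`. The inequality in `mono` lets terms of lower
-- degree be added, and `ext` admits functions that are computed from lists and agree with a
-- polynomial only pointwise.
data Poly {r} (m : ℕ) : (Vec ℕ r → ℚ) → Set where
  mono : ∀ q es → Vec.sum es ≤ m → Poly m (λ cs → q *ℚ ℕtoℚ (monomial es cs))
  add  : ∀ {f g} → Poly m f → Poly m g → Poly m (λ cs → f cs +ℚ g cs)
  ext  : ∀ {f g} → (∀ cs → f cs ≡ g cs) → Poly m f → Poly m g

sumℚ : ∀ {A : Set} → (A → ℚ) → List A → ℚ
sumℚ f []       = 0ℚ
sumℚ f (x ∷ xs) = f x +ℚ sumℚ f xs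

sumℚ-cong : ∀ {A : Set} {f g : A → ℚ} → (∀ x → f x ≡ g x) → ∀ xs → sumℚ f xs ≡ sumℚ g xs
sumℚ-cong f≗g []       = refl
sumℚ-cong f≗g (x ∷ xs) = cong₂ _+ℚ_ (f≗g x) (sumℚ-cong f≗g xs)

sumℚ-+ : ∀ {A : Set} (f g : A → ℚ) xs → sumℚ (λ x → f x +ℚ g x) xs ≡ sumℚ f xs +ℚ sumℚ g xs
sumℚ-+ f g []       = refl
sumℚ-+ f g (x ∷ xs) = trans (cong (f x +ℚ g x +ℚ_) (sumℚ-+ f g xs))
  (solve 4 (λ a b c d → (a :+ b) :+ (c :+ d) := (a :+ c) :+ (b :+ d)) refl (f x) (g x) (sumℚ f xs) (sumℚ g xs))

sumℚ-*-ℕtoℚ : ∀ {A : Set} q (f : A → ℕ) xs → sumℚ (λ x → q *ℚ ℕtoℚ (f x)) xs ≡ q *ℚ ℕtoℚ (sum (map f xs))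
sumℚ-*-ℕtoℚ q f []       = sym (ℚ.*-zeroʳ q)
sumℚ-*-ℕtoℚ q f (x ∷ xs) = begin
  q *ℚ ℕtoℚ (f x) +ℚ sumℚ (λ x → q *ℚ ℕtoℚ (f x)) xs    ≡⟨ cong (q *ℚ ℕtoℚ (f x) +ℚ_) (sumℚ-*-ℕtoℚ q f xs) ⟩
  q *ℚ ℕtoℚ (f x) +ℚ q *ℚ ℕtoℚ (sum (map f xs))         ≡⟨ ℚ.*-distribˡ-+ q (ℕtoℚ (f x)) (ℕtoℚ (sum (map f xs))) ⟨
  q *ℚ (ℕtoℚ (f x) +ℚ ℕtoℚ (sum (map f xs)))            ≡⟨ cong (q *ℚ_) (ℕtoℚ-+ (f x) (sum (map f xs))) ⟨
  q *ℚ ℕtoℚ (f x + sum (map f xs))                      ∎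
  where open ≡-Reasoning

module _ {u : ℕ → ℕ → ℕ} (u≤d : ∀ i d → 1 ≤ d → u d i ≤ d) (d≤1+u : ∀ i d → 1 ≤ d → d ≤ suc (u d i)) where

  -- In state `true`, a nonzero head always attains the full degree: the power sum supplies e + 1
  -- and the state `false` the rest. A zero head may fall short and is lifted by `asymptotic-≤`. So
  -- the positive coefficient required for the count comes from the nonzero heads, and nonnegativity
  -- is carried along to prevent cancellation. With positive exponents the coefficient can vanish:
  -- two adjacent ones make the monomial zero on every admissible vector.
  momentSum-asymptotic : ∀ b i {r} (es : Vec ℕ r) → ∃ λ a → 0ℚ ≤ℚ a × (Vec.sum es ≡ 0 → 0ℚ <ℚ a) ×
    Asymptotic (Vec.sum es + rank b r) a (λ d → ℕtoℚ (momentSum (u d) b i es))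
  momentSum-asymptotic false i [] = 1ℚ , ℚ.nonNegative⁻¹ 1ℚ , (λ _ → ℚ.positive⁻¹ 1ℚ) , asymptotic-const 1ℚ
  momentSum-asymptotic true  i [] = 1ℚ , ℚ.nonNegative⁻¹ 1ℚ , (λ _ → ℚ.positive⁻¹ 1ℚ) , asymptotic-const 1ℚ
  momentSum-asymptotic false i (zero ∷ es) =
    let a , 0≤a , 0<a , A = momentSum-asymptotic true (suc i) es in
    a , 0≤a , 0<a , asymptotic-cong (λ d _ → cong ℕtoℚ (sym
      (trans (momentSum-skip 0 es (enum (u d) true (suc i) _)) (*-identityˡ _)))) A
  momentSum-asymptotic false i (suc e ∷ es) = 0ℚ , ℚ.≤-refl , (λ ()) ,
    asymptotic-cong (λ d _ → cong ℕtoℚ (sym (momentSum-skip (suc e) es (enum (u d) true (suc i) _)))) (asymptotic-0 _)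
  momentSum-asymptotic true i {suc r} (e ∷ es) =
    let a , 0≤a , _   , A = momentSum-asymptotic true (suc i) es
        b , 0≤b , 0<b , B = momentSum-asymptotic false (suc i) es
        a′ , 0≤a′ , A′    = asymptotic-≤ skip-degree (*-nonNeg (0≤ℕtoℚ (0 ^ e)) 0≤a)
                              (asymptotic-* (asymptotic-const (ℕtoℚ (0 ^ e))) A)
        B′ = subst (λ m → Asymptotic m (q *ℚ b) (λ d → ℕtoℚ (powerSum e (u d i)) *ℚ ℕtoℚ (momentSum (u d) false (suc i) es)))
               pick-degree
               (asymptotic-* (powerSum-asymptotic {λ d → u d i} (u≤d i) (d≤1+u i) e) B)
    in a′ +ℚ q *ℚ b
     , ℚ.+-mono-≤ 0≤a′ (*-nonNeg (ℚ.<⇒≤ 0<q) 0≤b)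
     , (λ Σ≡0 → ℚ.+-mono-≤-< 0≤a′ (*-pos 0<q (0<b (m+n≡0⇒n≡0 e Σ≡0))))
     , asymptotic-cong (λ d _ → sym (split d)) (asymptotic-+ A′ B′)
    where
    q = ℤ.+ 1 /ℚ suc e
    0<q : 0ℚ <ℚ q
    0<q = ℚ.positive⁻¹ q {{ℚ.normalize-pos 1 (suc e)}}
    skip-degree : Vec.sum es + ⌊ suc r /2⌋ ≤ e + Vec.sum es + suc ⌊ r /2⌋
    skip-degree = +-mono-≤ (m≤n+m (Vec.sum es) e) (⌊n/2⌋-mono (n≤1+n (suc r)))
    pick-degree : suc e + (Vec.sum es + ⌊ r /2⌋) ≡ e + Vec.sum es + suc ⌊ r /2⌋
    pick-degree = lemma e (Vec.sum es) ⌊ r /2⌋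
      where
      lemma : ∀ a b c → suc a + (b + c) ≡ a + b + suc c
      lemma = solve-∀
    split : ∀ d → ℕtoℚ (momentSum (u d) true i (e ∷ es)) ≡
      ℕtoℚ (0 ^ e) *ℚ ℕtoℚ (momentSum (u d) true (suc i) es) +ℚ
      ℕtoℚ (powerSum e (u d i)) *ℚ ℕtoℚ (momentSum (u d) false (suc i) es)
    split d = trans (cong ℕtoℚ (momentSum-true (u d) i e es)) (trans
      (ℕtoℚ-+ (0 ^ e * momentSum (u d) true (suc i) es) (powerSum e (u d i) * momentSum (u d) false (suc i) es))
      (cong₂ _+ℚ_ (ℕtoℚ-* (0 ^ e) (momentSum (u d) true (suc i) es))
                  (ℕtoℚ-* (powerSum e (u d i)) (momentSum (u d) false (suc i) es))))

  poly-asymptotic : ∀ b i {r m} {f : Vec ℕ r → ℚ} → Poly m f →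
    ∃ λ a → Asymptotic (m + rank b r) a (λ d → sumℚ f (enum (u d) b i r))
  poly-asymptotic b i {r} (mono q es Σ≤m) =
    let a , 0≤a , _ , A = momentSum-asymptotic b i es
        a′ , _ , A′     = asymptotic-≤ (+-monoˡ-≤ (rank b r) Σ≤m) 0≤a A
    in q *ℚ a′ , asymptotic-cong (λ d _ → sym (sumℚ-*-ℕtoℚ q (monomial es) (enum (u d) b i r)))
                   (asymptotic-* (asymptotic-const q) A′)
  poly-asymptotic b i {r} (add {f} {g} F G) =
    let a , A = poly-asymptotic b i F; a′ , A′ = poly-asymptotic b i G in
    a +ℚ a′ , asymptotic-cong (λ d _ → sym (sumℚ-+ f g (enum (u d) b i r))) (asymptotic-+ A A′)
  poly-asymptotic b i {r} (ext f≗g F) =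
    let a , A = poly-asymptotic b i F in
    a , asymptotic-cong (λ d _ → sumℚ-cong f≗g (enum (u d) b i r)) A

-- Closure properties of polynomials in the runner lengths

monomial-* : ∀ {r} (es fs cs : Vec ℕ r) → monomial (Vec.zipWith _+_ es fs) cs ≡ monomial es cs * monomial fs cs
monomial-* []       []       []       = refl
monomial-* (e ∷ es) (f ∷ fs) (c ∷ cs) = trans
  (cong₂ _*_ (^-distribˡ-+-* c e f) (monomial-* es fs cs)) (lemma (c ^ e) (c ^ f) _ _)
  where
  lemma : ∀ a b c d → a * b * (c * d) ≡ a * c * (b * d)
  lemma = solve-∀

sum-zipWith-+ : ∀ {r} (es fs : Vec ℕ r) → Vec.sum (Vec.zipWith _+_ es fs) ≡ Vec.sum es + Vec.sum fs
sum-zipWith-+ []       []       = refl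
sum-zipWith-+ (e ∷ es) (f ∷ fs) = trans (cong (e + f +_) (sum-zipWith-+ es fs)) (lemma e f _ _)
  where
  lemma : ∀ a b c d → a + b + (c + d) ≡ a + c + (b + d)
  lemma = solve-∀

sum-replicate-0 : ∀ r → Vec.sum (Vec.replicate r 0) ≡ 0
sum-replicate-0 zero    = refl
sum-replicate-0 (suc r) = sum-replicate-0 r

monomial-0 : ∀ {r} (cs : Vec ℕ r) → monomial (Vec.replicate r 0) cs ≡ 1
monomial-0 []       = refl
monomial-0 (c ∷ cs) = trans (*-identityˡ _) (monomial-0 cs)

module _ {r : ℕ} where

  poly-* : ∀ {m n} {f g : Vec ℕ r → ℚ} → Poly m f → Poly n g → Poly (m + n) (λ cs → f cs *ℚ g cs)
  poly-* (mono p es Σ≤m) (mono q fs Σ≤n) = ext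
    (λ cs → trans (cong (p *ℚ q *ℚ_) (trans (cong ℕtoℚ (monomial-* es fs cs)) (ℕtoℚ-* (monomial es cs) (monomial fs cs))))
      (solve 4 (λ p q x y → p :* q :* (x :* y) := p :* x :* (q :* y)) refl
        p q (ℕtoℚ (monomial es cs)) (ℕtoℚ (monomial fs cs))))
    (mono (p *ℚ q) (Vec.zipWith _+_ es fs)
      (≤-trans (≤-reflexive (sum-zipWith-+ es fs)) (+-mono-≤ Σ≤m Σ≤n)))
  poly-* {f = f} F@(mono _ _ _) (add {g} {h} G H) =
    ext (λ cs → sym (ℚ.*-distribˡ-+ (f cs) (g cs) (h cs))) (add (poly-* F G) (poly-* F H))
  poly-* {f = f} F@(mono _ _ _) (ext g≗h G) = ext (λ cs → cong (f cs *ℚ_) (g≗h cs)) (poly-* F G)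
  poly-* {g = g} (add {f} {h} F H) G = ext (λ cs → sym (ℚ.*-distribʳ-+ (g cs) (f cs) (h cs))) (add (poly-* F G) (poly-* H G))
  poly-* {g = g} (ext f≗h F) G = ext (λ cs → cong (_*ℚ g cs) (f≗h cs)) (poly-* F G)

  poly-≤ : ∀ {m n} {f : Vec ℕ r → ℚ} → m ≤ n → Poly m f → Poly n f
  poly-≤ m≤n (mono q es Σ≤m) = mono q es (≤-trans Σ≤m m≤n)
  poly-≤ m≤n (add F G)       = add (poly-≤ m≤n F) (poly-≤ m≤n G)
  poly-≤ m≤n (ext f≗g F)     = ext f≗g (poly-≤ m≤n F)

  poly-const : ∀ q → Poly {r} 0 (λ _ → q)
  poly-const q = ext (λ cs → trans (cong (λ x → q *ℚ ℕtoℚ x) (monomial-0 cs)) (ℚ.*-identityʳ q))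
    (mono q (Vec.replicate r 0) (≤-reflexive (sum-replicate-0 r)))

  poly-scale : ∀ {m} {f : Vec ℕ r → ℚ} q → Poly m f → Poly m (λ cs → q *ℚ f cs)
  poly-scale q F = poly-* (poly-const q) F

  poly-head : Poly {suc r} 1 (λ cs → ℕtoℚ (Vec.head cs))
  poly-head = ext (λ { (c ∷ cs) → trans (ℚ.*-identityˡ _) (cong ℕtoℚ
      (trans (cong₂ _*_ (*-identityʳ c) (monomial-0 cs)) (*-identityʳ c))) })
    (mono 1ℚ (1 ∷ Vec.replicate r 0) (s≤s (≤-reflexive (sum-replicate-0 r))))

  poly-tail : ∀ {m} {f : Vec ℕ r → ℚ} → Poly m f → Poly m (λ cs → f (Vec.tail cs))
  poly-tail (mono q es Σ≤m) = ext (λ { (c ∷ cs) → cong (λ x → q *ℚ ℕtoℚ x) (*-identityˡ (monomial es cs)) })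
    (mono q (0 ∷ es) Σ≤m)
  poly-tail (add F G)       = add (poly-tail F) (poly-tail G)
  poly-tail (ext f≗g F)     = ext (λ cs → f≗g (Vec.tail cs)) (poly-tail F)

  poly-^ : ∀ {m} {f : Vec ℕ r → ℕ} → Poly m (λ cs → ℕtoℚ (f cs)) → ∀ k → Poly (k * m) (λ cs → ℕtoℚ (f cs ^ k))
  poly-^         F zero    = poly-const 1ℚ
  poly-^ {f = f} F (suc k) = ext (λ cs → sym (ℕtoℚ-* (f cs) (f cs ^ k))) (poly-* F (poly-^ F k))

-- Moments of the size

-- The binomial coefficient x (x - 1) / 2, written with sums and scalings to fit the closure
-- properties of `Poly`.
choose₂ : ℚ → ℚ
choose₂ x = ½ *ℚ (x *ℚ x +ℚ -ℚ 1ℚ *ℚ x)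

poly-choose₂ : ∀ {r} {f : Vec ℕ r → ℚ} → Poly 1 f → Poly 2 (λ cs → choose₂ (f cs))
poly-choose₂ F = poly-scale ½ (add (poly-* F F) (poly-scale (-ℚ 1ℚ) (poly-≤ (s≤s z≤n) F)))

triangle-choose₂ : ∀ l → ℕtoℚ (triangle l) ≡ choose₂ (ℕtoℚ l)
triangle-choose₂ zero    = refl
triangle-choose₂ (suc l) = begin
  ℕtoℚ (triangle l + l)               ≡⟨ ℕtoℚ-+ (triangle l) l ⟩
  ℕtoℚ (triangle l) +ℚ ℕtoℚ l         ≡⟨ cong (_+ℚ ℕtoℚ l) (triangle-choose₂ l) ⟩
  choose₂ (ℕtoℚ l) +ℚ ℕtoℚ l
    ≡⟨ solve 1 (λ x → con ½ :* (x :* x :+ con (-ℚ 1ℚ) :* x) :+ x :=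
         con ½ :* ((con 1ℚ :+ x) :* (con 1ℚ :+ x) :+ con (-ℚ 1ℚ) :* (con 1ℚ :+ x))) refl (ℕtoℚ l) ⟩
  choose₂ (1ℚ +ℚ ℕtoℚ l)              ≡⟨ cong choose₂ (ℕtoℚ-+ 1 l) ⟨
  choose₂ (ℕtoℚ (suc l))              ∎
  where open ≡-Reasoning

module AbacusSums (n : ℕ) .{{_ : NonZero n}} where

  open Residues n

  progression-sum : ∀ i c → ℕtoℚ (sum (progression i c)) ≡ ℕtoℚ n *ℚ choose₂ (ℕtoℚ c) +ℚ ℕtoℚ i *ℚ ℕtoℚ c
  progression-sum i zero    = sym (solve 2 (λ n i → n :* con 0ℚ :+ i :* con 0ℚ := con 0ℚ) refl (ℕtoℚ n) (ℕtoℚ i))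
  progression-sum i (suc c) = begin
    ℕtoℚ (i + c * n + sum (progression i c))
      ≡⟨ trans (ℕtoℚ-+ (i + c * n) _) (cong₂ _+ℚ_
           (trans (ℕtoℚ-+ i (c * n)) (cong (ℕtoℚ i +ℚ_) (ℕtoℚ-* c n))) (progression-sum i c)) ⟩
    ℕtoℚ i +ℚ ℕtoℚ c *ℚ ℕtoℚ n +ℚ (ℕtoℚ n *ℚ choose₂ (ℕtoℚ c) +ℚ ℕtoℚ i *ℚ ℕtoℚ c)
      ≡⟨ solve 3 (λ i c n → i :+ c :* n :+ (n :* (con ½ :* (c :* c :+ con (-ℚ 1ℚ) :* c)) :+ i :* c) :=
           n :* (con ½ :* ((con 1ℚ :+ c) :* (con 1ℚ :+ c) :+ con (-ℚ 1ℚ) :* (con 1ℚ :+ c))) :+ i :* (con 1ℚ :+ c))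
           refl (ℕtoℚ i) (ℕtoℚ c) (ℕtoℚ n) ⟩
    ℕtoℚ n *ℚ choose₂ (1ℚ +ℚ ℕtoℚ c) +ℚ ℕtoℚ i *ℚ (1ℚ +ℚ ℕtoℚ c)
      ≡⟨ cong (λ x → ℕtoℚ n *ℚ choose₂ x +ℚ ℕtoℚ i *ℚ x) (ℕtoℚ-+ 1 c) ⟨
    ℕtoℚ n *ℚ choose₂ (ℕtoℚ (suc c)) +ℚ ℕtoℚ i *ℚ ℕtoℚ (suc c) ∎
    where open ≡-Reasoning

  abacus-sum-poly : ∀ i r → Poly {r} 2 (λ cs → ℕtoℚ (sum (abacus i cs)))
  abacus-sum-poly i zero    = ext (λ { [] → refl }) (poly-≤ z≤n (poly-const 0ℚ))
  abacus-sum-poly i (suc r) = ext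
    (λ { (c ∷ cs) → sym (trans (cong ℕtoℚ (sum-++ (progression i c) (abacus (suc i) cs)))
           (trans (ℕtoℚ-+ (sum (progression i c)) _) (cong (_+ℚ ℕtoℚ (sum (abacus (suc i) cs))) (progression-sum i c)))) })
    (add (add (poly-scale (ℕtoℚ n) (poly-choose₂ poly-head)) (poly-scale (ℕtoℚ i) (poly-≤ (s≤s z≤n) poly-head)))
         (poly-tail (abacus-sum-poly (suc i) r)))

  abacus-length-poly : ∀ i r → Poly {r} 1 (λ cs → ℕtoℚ (length (abacus i cs)))
  abacus-length-poly i zero    = ext (λ { [] → refl }) (poly-≤ z≤n (poly-const 0ℚ))
  abacus-length-poly i (suc r) = ext
    (λ { (c ∷ cs) → sym (trans (cong ℕtoℚ (trans (length-++ (progression i c))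
           (cong (_+ length (abacus (suc i) cs)) (length-applyDownFrom (λ j → i + j * n) c))))
           (ℕtoℚ-+ c (length (abacus (suc i) cs)))) })
    (add poly-head (poly-tail (abacus-length-poly (suc i) r)))

-- A lower bound for the count, and quotients of asymptotics

length-cartesianProductWith : ∀ {A B C : Set} (f : A → B → C) xs ys →
                              length (cartesianProductWith f xs ys) ≡ length xs * length ys
length-cartesianProductWith f []       ys = refl
length-cartesianProductWith f (x ∷ xs) ys = trans (length-++ (map (f x) ys))
  (cong₂ _+_ (length-map (f x) ys) (length-cartesianProductWith f xs ys))

-- It suffices to count the vectors with a nonzero entry whenever the state permits one: there are
-- `rank b r` such places, each with u i ≥ d / 2 values.
enum-length-lower : ∀ {d u} → (∀ i → d ≤ 2 * u i) → ∀ b i r → d ^ rank b r ≤ 2 ^ rank b r * length (enum u b i r)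
enum-length-lower d≤2u true  i zero    = ≤-refl
enum-length-lower d≤2u false i zero    = ≤-refl
enum-length-lower {d} {u} d≤2u false i (suc r) = subst (λ l → d ^ rank true r ≤ 2 ^ rank true r * l)
  (sym (length-map (0 ∷_) (enum u true (suc i) r))) (enum-length-lower d≤2u true (suc i) r)
enum-length-lower {d} {u} d≤2u true  i (suc r) = begin
  d * d ^ g                               ≤⟨ *-mono-≤ (d≤2u i) (enum-length-lower d≤2u false (suc i) r) ⟩
  2 * u i * (2 ^ g * length ys)           ≡⟨ lemma (u i) (2 ^ g) (length ys) ⟩
  2 * 2 ^ g * (u i * length ys)           ≤⟨ *-monoʳ-≤ (2 * 2 ^ g) bound ⟩
  2 * 2 ^ g * length (enum u true i (suc r)) ∎
  where
  open ≤-Reasoning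
  g  = rank false r
  xs = map (0 ∷_) (enum u true (suc i) r)
  ys = enum u false (suc i) r
  lemma : ∀ a b c → 2 * a * (b * c) ≡ 2 * b * (a * c)
  lemma = solve-∀
  bound : u i * length ys ≤ length (enum u true i (suc r))
  bound = begin
    u i * length ys                                          ≡⟨ cong (_* length ys) (length-applyDownFrom suc (u i)) ⟨
    length (applyDownFrom suc (u i)) * length ys             ≡⟨ length-cartesianProductWith _∷_ (applyDownFrom suc (u i)) ys ⟨
    length (cartesianProductWith _∷_ (applyDownFrom suc (u i)) ys) ≤⟨ m≤n+m _ (length xs) ⟩
    length xs + length (cartesianProductWith _∷_ (applyDownFrom suc (u i)) ys) ≡⟨ length-++ xs ⟨
    length (enum u true i (suc r))                           ∎

momentSum-0 : ∀ u b i r → momentSum u b i (Vec.replicate r 0) ≡ length (enum u b i r)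
momentSum-0 u b i r = go (enum u b i r)
  where
  go : ∀ xs → sum (map (monomial (Vec.replicate r 0)) xs) ≡ length xs
  go []       = refl
  go (x ∷ xs) = cong₂ _+_ (monomial-0 x) (go xs)

moment-length : ∀ k L → moment k L *ℚ ℕtoℚ (length L) ≡ ℕtoℚ (sum (map (λ λs → size λs ^ k) L))
moment-length k []       = refl
moment-length k (λs ∷ L) = /-*-cancel (sum (map (λ λs → size λs ^ k) (λs ∷ L))) (length L)

asymptotic-^ : ∀ m → Asymptotic m 1ℚ (λ d → ℕtoℚ (d ^ m))
asymptotic-^ m = 0ℚ , λ d _ → ℚ.≤-reflexive (trans
  (cong (λ x → ∣ x ∣ *ℚ ℕtoℚ d) (solve 1 (λ x → x :- con 1ℚ :* x := con 0ℚ) refl (ℕtoℚ (d ^ m))))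
  (trans (ℚ.*-zeroˡ (ℕtoℚ d)) (sym (ℚ.*-zeroˡ (ℕtoℚ (d ^ m))))))

-- Multiplied by the denominator, the error becomes num - C dᵐ⁺¹ den. Its coefficient of order m + 1
-- + g is a - (a / b) b = 0, so it is O(dᵐ⁺ᵍ), and den ≥ dᵍ / c turns this into O(dᵐ). The quotient
-- `X` enters through X · den = num, which avoids dividing by `den`.
quotient-asymptotic : ∀ {m g a b} {num den : ℕ → ℚ} → 0ℚ <ℚ b →
  Asymptotic (suc m + g) a num → Asymptotic g b den →
  ∃ λ C → ∃ λ K → ∀ c d X → 1 ≤ d → ℕtoℚ (d ^ g) ≤ℚ ℕtoℚ c *ℚ den d → X *ℚ den d ≡ num d →
    ∣ X - C *ℚ ℕtoℚ (d ^ suc m) ∣ ≤ℚ ℕtoℚ c *ℚ K *ℚ ℕtoℚ (d ^ m)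
quotient-asymptotic {m} {g} {a} {b} {num} {den} 0<b A B = C , K , final
  where
  instance
    b>0 : Positive b
    b>0 = positive 0<b
    b≢0 = ℚ.pos⇒nonZero b
  C = a *ℚ 1/ b

  difference : Asymptotic (suc m + g) 0ℚ (λ d → num d +ℚ -ℚ C *ℚ (ℕtoℚ (d ^ suc m) *ℚ den d))
  difference = subst (λ x → Asymptotic (suc m + g) x (λ d → num d +ℚ -ℚ C *ℚ (ℕtoℚ (d ^ suc m) *ℚ den d))) cancel
    (asymptotic-+ A (asymptotic-* (asymptotic-const (-ℚ C)) (asymptotic-* (asymptotic-^ (suc m)) B)))
    where
    open ≡-Reasoning
    cancel : a +ℚ -ℚ C *ℚ (1ℚ *ℚ b) ≡ 0ℚ
    cancel = begin
      a +ℚ -ℚ (a *ℚ 1/ b) *ℚ (1ℚ *ℚ b)   ≡⟨ solve 3 (λ a c b → a :+ :- (a :* c) :* (con 1ℚ :* b) := a :- a :* (c :* b)) refl a (1/ b) b ⟩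
      a - a *ℚ (1/ b *ℚ b)               ≡⟨ cong (λ x → a - a *ℚ x) (ℚ.*-inverseˡ b) ⟩
      a - a *ℚ 1ℚ                        ≡⟨ solve 1 (λ a → a :- a :* con 1ℚ := con 0ℚ) refl a ⟩
      0ℚ                                 ∎

  open Asymptotic difference renaming (constant to K; bound to difference-bound)

  final : ∀ c d X → 1 ≤ d → ℕtoℚ (d ^ g) ≤ℚ ℕtoℚ c *ℚ den d → X *ℚ den d ≡ num d →
          ∣ X - C *ℚ ℕtoℚ (d ^ suc m) ∣ ≤ℚ ℕtoℚ c *ℚ K *ℚ ℕtoℚ (d ^ m)
  final c d X 1≤d lower X*den = ℚ.*-cancelʳ-≤-pos (G *ℚ x)
    {{ℚ.pos*pos⇒pos G {{ℕtoℚ-pos (d ^ g) {{m^n≢0 d g {{>-nonZero 1≤d}}}}}} x {{ℕtoℚ-pos d {{>-nonZero 1≤d}}}}}} (begin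
    h *ℚ (G *ℚ x)                         ≤⟨ ℚ.*-monoˡ-≤-nonNeg h {{ℚ.∣-∣-nonNeg (X - C *ℚ E)}}
                                               (ℚ.*-monoʳ-≤-nonNeg x {{ℕtoℚ-nonNeg d}} lower) ⟩
    h *ℚ (κ *ℚ N *ℚ x)                    ≡⟨ solve 4 (λ h κ N x → h :* (κ :* N :* x) := κ :* (h :* N :* x)) refl h κ N x ⟩
    κ *ℚ (h *ℚ N *ℚ x)                    ≤⟨ ℚ.*-monoˡ-≤-nonNeg κ {{ℕtoℚ-nonNeg c}} scaled ⟩
    κ *ℚ (K *ℚ ℕtoℚ (d ^ (suc m + g)))    ≡⟨ cong (λ y → κ *ℚ (K *ℚ y)) (trans (cong ℕtoℚ (^-distribˡ-+-* d (suc m) g))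
                                               (trans (ℕtoℚ-* (d * d ^ m) (d ^ g)) (cong (_*ℚ G) (ℕtoℚ-* d (d ^ m))))) ⟩
    κ *ℚ (K *ℚ (x *ℚ E′ *ℚ G))            ≡⟨ solve 5 (λ κ K x E G → κ :* (K :* (x :* E :* G)) := κ :* K :* E :* (G :* x)) refl κ K x E′ G ⟩
    κ *ℚ K *ℚ E′ *ℚ (G *ℚ x)              ∎)
    where
    open ℚ.≤-Reasoning
    x = ℕtoℚ d
    G = ℕtoℚ (d ^ g)
    E = ℕtoℚ (d ^ suc m)
    E′ = ℕtoℚ (d ^ m)
    N = den d
    κ = ℕtoℚ c
    h = ∣ X - C *ℚ E ∣
    scaled : h *ℚ N *ℚ x ≤ℚ K *ℚ ℕtoℚ (d ^ (suc m + g))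
    scaled = begin
      h *ℚ N *ℚ x                                   ≤⟨ ℚ.*-monoʳ-≤-nonNeg x {{ℕtoℚ-nonNeg d}}
                                                         (ℚ.*-monoˡ-≤-nonNeg h {{ℚ.∣-∣-nonNeg (X - C *ℚ E)}} N≤∣N∣) ⟩
      h *ℚ ∣ N ∣ *ℚ x                               ≡⟨ cong (_*ℚ x) (ℚ.∣p*q∣≡∣p∣*∣q∣ (X - C *ℚ E) N) ⟨
      ∣ (X - C *ℚ E) *ℚ N ∣ *ℚ x
        -- The zero summand is inserted to match the leading term of `difference`, whose coefficient
        -- is 0.
        ≡⟨ cong (λ y → ∣ y ∣ *ℚ x) (trans (solve 5 (λ X C E N D → (X :- C :* E) :* N := (X :* N :+ :- C :* (E :* N)) :- con 0ℚ :* D)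
             refl X C E N (ℕtoℚ (d ^ (suc m + g))))
             (cong (λ y → (y +ℚ -ℚ C *ℚ (E *ℚ N)) - 0ℚ *ℚ ℕtoℚ (d ^ (suc m + g))) X*den)) ⟩
      ∣ num d +ℚ -ℚ C *ℚ (E *ℚ N) - 0ℚ *ℚ ℕtoℚ (d ^ (suc m + g)) ∣ *ℚ x ≤⟨ difference-bound d 1≤d ⟩
      K *ℚ ℕtoℚ (d ^ (suc m + g))                   ∎
      where
      N≤∣N∣ : N ≤ℚ ∣ N ∣
      N≤∣N∣ with ℚ.≤-total 0ℚ N
      ... | inj₁ 0≤N = ℚ.≤-reflexive (sym (ℚ.0≤p⇒∣p∣≡p 0≤N))
      ... | inj₂ N≤0 = ℚ.≤-trans N≤0 (ℚ.0≤∣p∣ N)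

module Moments (r : ℕ) where

  open Classification r
  open Residues n
  open AbacusSums n

  -- The beads of a runner form an arithmetic progression, so their sum is quadratic in its length;
  -- the number of beads is linear and enters through `choose₂`.
  size-poly : Poly {r} 2 (λ cs → ℕtoℚ (size (fromRunners cs)))
  size-poly = ext eq (add (abacus-sum-poly 1 r) (poly-scale (-ℚ 1ℚ) (poly-choose₂ (abacus-length-poly 1 r))))
    where
    open ≡-Reasoning
    eq : ∀ cs → ℕtoℚ (sum (abacus 1 cs)) +ℚ -ℚ 1ℚ *ℚ choose₂ (ℕtoℚ (length (abacus 1 cs))) ≡ ℕtoℚ (size (fromRunners cs))
    eq cs = begin
      ℕtoℚ (sum (abacus 1 cs)) +ℚ -ℚ 1ℚ *ℚ choose₂ (ℕtoℚ l)
        ≡⟨ cong₂ (λ x y → x +ℚ -ℚ 1ℚ *ℚ y) (cong ℕtoℚ (sym (size-fromRunners cs))) (sym (triangle-choose₂ l)) ⟩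
      ℕtoℚ (s + triangle l) +ℚ -ℚ 1ℚ *ℚ ℕtoℚ (triangle l)
        ≡⟨ cong (_+ℚ -ℚ 1ℚ *ℚ ℕtoℚ (triangle l)) (ℕtoℚ-+ s (triangle l)) ⟩
      ℕtoℚ s +ℚ ℕtoℚ (triangle l) +ℚ -ℚ 1ℚ *ℚ ℕtoℚ (triangle l)
        ≡⟨ solve 2 (λ s t → s :+ t :+ con (-ℚ 1ℚ) :* t := s) refl (ℕtoℚ s) (ℕtoℚ (triangle l)) ⟩
      ℕtoℚ s ∎
      where
      l = length (abacus 1 cs)
      s = size (fromRunners cs)

  module _ {u : ℕ → ℕ → ℕ} (u≤d : ∀ i d → 1 ≤ d → u d i ≤ d) (d≤1+u : ∀ i d → 1 ≤ d → d ≤ suc (u d i)) where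

    moment-asymptotic : ∀ k → 1 ≤ k → ∃ λ C → ∃ λ M → ∀ d → 2 ≤ d →
      ∀ {L} → L ↭ map fromRunners (enum (u d) true 1 r) →
      ∣ moment k L - C *ℚ ℕtoℚ (d ^ (2 * k)) ∣ ≤ℚ M *ℚ ℕtoℚ (d ^ (2 * k ∸ 1))
    moment-asymptotic (suc k) _ = C , ℕtoℚ (2 ^ g) *ℚ K , λ d 2≤d {L} L↭ →
      let E = enum (u d) true 1 r
          1≤d = ≤-trans (n≤1+n 1) 2≤d
          length≡ : length L ≡ length E
          length≡ = trans (↭-length L↭) (length-map fromRunners E)
          sum≡ : sum (map power L) ≡ sum (map (λ cs → power (fromRunners cs)) E)
          sum≡ = trans (sum-↭ (↭-map⁺ power L↭)) (cong sum (sym (map-∘ {g = power} {f = fromRunners} E)))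
          lower : ℕtoℚ (d ^ g) ≤ℚ ℕtoℚ (2 ^ g) *ℚ ℕtoℚ (length E)
          lower = ℚ.≤-trans (ℕtoℚ-mono (enum-length-lower (λ i → d≤2*u 2≤d (d≤1+u i d 1≤d)) true 1 r))
                    (ℚ.≤-reflexive (ℕtoℚ-* (2 ^ g) (length E)))
          X*den : moment (suc k) L *ℚ ℕtoℚ (length E) ≡ ℕtoℚ (sum (map (λ cs → power (fromRunners cs)) E))
          X*den = trans (cong (λ l → moment (suc k) L *ℚ ℕtoℚ l) (sym length≡)) (trans (moment-length (suc k) L) (cong ℕtoℚ sum≡))
      in proj₂ (proj₂ quotient) (2 ^ g) d (moment (suc k) L) 1≤d lower X*den
      where
      g = rank true r
      power : List ℕ → ℕ
      power λs = size λs ^ suc k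
      numerator = poly-asymptotic u≤d d≤1+u true 1 (poly-^ {f = λ cs → size (fromRunners cs)} size-poly (suc k))
      denominator = momentSum-asymptotic u≤d d≤1+u true 1 (Vec.replicate r 0)
      -- `poly-^` produces the exponent (k + 1) · 2, while the quotient needs a successor; the
      -- subtraction does not truncate, since 2 · (k + 1) is positive.
      degree : suc k * 2 + g ≡ suc (2 * suc k ∸ 1) + g
      degree = cong (_+ g) (*-comm (suc k) 2)
      sumℚ-ℕtoℚ : ∀ {A : Set} (f : A → ℕ) xs → sumℚ (λ x → ℕtoℚ (f x)) xs ≡ ℕtoℚ (sum (map f xs))
      sumℚ-ℕtoℚ f xs = trans (sumℚ-cong (λ x → sym (ℚ.*-identityˡ (ℕtoℚ (f x)))) xs)
        (trans (sumℚ-*-ℕtoℚ 1ℚ f xs) (ℚ.*-identityˡ _))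
      quotient = quotient-asymptotic {2 * suc k ∸ 1} {g}
        {num = λ d → ℕtoℚ (sum (map (λ cs → power (fromRunners cs)) (enum (u d) true 1 r)))}
        {den = λ d → ℕtoℚ (length (enum (u d) true 1 r))}
        (proj₁ (proj₂ (proj₂ denominator)) (sum-replicate-0 r))
        (asymptotic-cong (λ d _ → sumℚ-ℕtoℚ (λ cs → power (fromRunners cs)) (enum (u d) true 1 r))
          (subst (λ m → Asymptotic m (proj₁ numerator) (λ d → sumℚ (λ cs → ℕtoℚ (power (fromRunners cs))) (enum (u d) true 1 r)))
            degree (proj₂ numerator)))
        (asymptotic-cong (λ d _ → cong ℕtoℚ (momentSum-0 (u d) true 1 r))
          (subst (λ m → Asymptotic (m + g) (proj₁ denominator) (λ d → ℕtoℚ (momentSum (u d) true 1 (Vec.replicate r 0))))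
            (sum-replicate-0 r) (proj₂ (proj₂ (proj₂ denominator)))))
      C = proj₁ quotient
      K = proj₁ (proj₂ quotient)
      -- This is where d ≥ 2 enters: it forces v ≥ 1, hence 1 + v ≤ 2 v. For d = 1 the last runner
      -- has capacity 0 in the minus case and the bound fails.
      d≤2*u : ∀ {d v} → 2 ≤ d → d ≤ suc v → d ≤ 2 * v
      d≤2*u {d} {v} 2≤d d≤1+v = ≤-trans d≤1+v (≤-trans
        (+-monoˡ-≤ v (s≤s⁻¹ (≤-trans 2≤d d≤1+v))) (≤-reflexive (cong (_+_ v) (sym (+-identityʳ v)))))

-- The moduli dn + 1 and dn - 1

module PlusOne (r d : ℕ) where

  n = suc r

  bound⇒ : ∀ {k j} → 0 < k → k + j * n < d * n + 1 → j < d
  bound⇒ {k} {j} 0<k k+jn<t with j <? d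
  ... | yes j<d = j<d
  ... | no j≮d = contradiction k+jn<t (≤⇒≯ (≤-trans (≤-reflexive (+-comm (d * n) 1))
    (+-mono-≤ 0<k (*-monoˡ-≤ n (≮⇒≥ j≮d)))))

  bound⇐ : ∀ {k j} → k < n → j < d → k + j * n < d * n + 1
  bound⇐ {k} {j} k<n j<d = <-≤-trans (+-monoˡ-< (j * n) k<n)
    (≤-trans (*-monoˡ-≤ n j<d) (m≤m+n (d * n) 1))

  -- A bead y + (d n + 1) is also (y + 1) + d n. Closure under d n + 1 gives the bead `y`, and `d`
  -- steps of closure under `n` give its neighbour y + 1.
  beads<t : ∀ {bs} → Sparse bs → Closed n bs → Closed (d * n + 1) bs → ∀ {x} → x ∈ bs → x < d * n + 1
  beads<t {bs} sparse n-closed t-closed {x} x∈ with x <? d * n + 1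
  ... | yes x<t = x<t
  ... | no x≮t with x ∸ (d * n + 1) | m∸n+n≡m (≮⇒≥ x≮t)
  ...   | y | refl = contradiction
    (closed-* n-closed d (subst (_∈ bs) (lemma y (d * n)) x∈)) (sparse (t-closed x∈))
    where
    lemma : ∀ y a → y + (a + 1) ≡ suc y + a
    lemma = solve-∀

module MinusOne (r d′ : ℕ) where

  n = suc r
  t = r + d′ * n

  -- The number `t` itself sits on runner `r` in row `d′`, so this runner has one position fewer
  -- below `t` than the others.
  bound : ℕ → ℕ
  bound i with i ≟ r
  ... | yes _ = d′
  ... | no  _ = suc d′

  bound≤ : ∀ i → bound i ≤ suc d′
  bound≤ i with i ≟ r
  ... | yes _ = n≤1+n d′
  ... | no  _ = ≤-refl

  ≤1+bound : ∀ i → suc d′ ≤ suc (bound i)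
  ≤1+bound i with i ≟ r
  ... | yes _ = ≤-refl
  ... | no  _ = n≤1+n (suc d′)

  bound⇒ : ∀ {k j} → k + j * n < t → j < bound k
  bound⇒ {k} {j} k+jn<t with k ≟ r
  ... | yes refl = *-cancelʳ-< n j d′ (+-cancelˡ-< r (j * n) (d′ * n) k+jn<t)
  ... | no  _ = *-cancelʳ-< n j (suc d′) (≤-<-trans (m≤n+m (j * n) k) (<-trans k+jn<t (n<1+n t)))

  bound⇐ : ∀ {k j} → k < n → j < bound k → k + j * n < t
  bound⇐ {k} {j} k<n j<bound with k ≟ r
  ... | yes refl = +-monoʳ-< r (*-monoˡ-< n j<bound)
  ... | no k≢r = +-mono-<-≤ (≤∧≢⇒< (s≤s⁻¹ k<n) k≢r) (*-monoˡ-≤ n (s≤s⁻¹ j<bound))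

  -- Here `suc t` is (d′ + 1) n, so a bead (y + 1) + t is also y + (d′ + 1) n, and the two closures
  -- give the neighbours y + 1 and `y`. The bead `t` itself would give the bead 0, which positivity
  -- excludes.
  beads<t : ∀ {bs} → All (0 <_) bs → Sparse bs → Closed n bs → Closed t bs → ∀ {x} → x ∈ bs → x < t
  beads<t {bs} pos sparse n-closed t-closed {x} x∈ with x <? t
  ... | yes x<t = x<t
  ... | no x≮t with x ∸ t | m∸n+n≡m (≮⇒≥ x≮t)
  ...   | zero  | refl = contradiction (All.lookup pos (t-closed {0} x∈)) λ ()
  ...   | suc y | refl = contradiction (t-closed x∈) (sparse (closed-* n-closed (suc d′) (subst (_∈ bs) (sym (+-suc y t)) x∈)))

theorem1p8 : (n k : ℕ) → 2 ≤ n → 1 ≤ k →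
    ∃ λ (C : ℚ) → ∃ λ (D : ℚ) → ∃ λ (M : ℚ) → ∃ λ (d₀ : ℕ) →
    ((d : ℕ) → 1 ≤ d → d₀ ≤ d → (L : List (List ℕ)) → Enumerates n (d * n + 1) L →
    ∣ moment k L - C *ℚ ℕtoℚ (d ^ (2 * k)) ∣ ≤ℚ M *ℚ ℕtoℚ (d ^ (2 * k ∸ 1)))
    × ((d : ℕ) → 1 ≤ d → d₀ ≤ d → (L : List (List ℕ)) → Enumerates n (d * n ∸ 1) L →
    ∣ moment k L - D *ℚ ℕtoℚ (d ^ (2 * k)) ∣ ≤ℚ M *ℚ ℕtoℚ (d ^ (2 * k ∸ 1)))
theorem1p8 (suc r) k (s≤s 1≤r) 1≤k = C , D , M ⊔ℚ N , 2
  , (λ d _ 2≤d L enumerates → ℚ.≤-trans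
       (boundᶜ d 2≤d (enumeration-↭ (≤-trans z<s (m≤n+m 1 (d * suc r)))
         (λ 0<k _ → PlusOne.bound⇒ r d 0<k) (λ _ → PlusOne.bound⇐ r d) (λ _ → PlusOne.beads<t r d) enumerates))
       (scale d (ℚ.p≤p⊔q M N)))
  -- Matching on `suc d` makes the modulus reduce to `MinusOne.t`, which is positive because n ≥ 2
  -- gives r ≥ 1.
  , (λ { (suc d) _ 2≤d L enumerates → ℚ.≤-trans
       (boundᵈ (suc d) 2≤d (enumeration-↭ (≤-trans 1≤r (m≤m+n r (d * suc r)))
         (λ _ _ → MinusOne.bound⇒ r d) (λ _ → MinusOne.bound⇐ r d) (MinusOne.beads<t r d) enumerates))
       (scale (suc d) (ℚ.p≤q⊔p M N)) })
  where
  open Classification r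
  open Moments r
  plus minus : ℕ → ℕ → ℕ
  plus d _ = d
  -- A placeholder value: the capacity bounds are required for d ≥ 1.
  minus zero    _ = 0
  minus (suc d)   = MinusOne.bound r d
  plusMoments  = moment-asymptotic {plus} (λ _ d _ → ≤-refl) (λ _ d _ → n≤1+n d) k 1≤k
  minusMoments = moment-asymptotic {minus} (λ { i (suc d) _ → MinusOne.bound≤ r d i })
                   (λ { i (suc d) _ → MinusOne.≤1+bound r d i }) k 1≤k
  C = proj₁ plusMoments
  M = proj₁ (proj₂ plusMoments)
  boundᶜ = proj₂ (proj₂ plusMoments)
  D = proj₁ minusMoments
  N = proj₁ (proj₂ minusMoments)
  boundᵈ = proj₂ (proj₂ minusMoments)
  scale : ∀ d {p q} → p ≤ℚ q → p *ℚ ℕtoℚ (d ^ (2 * k ∸ 1)) ≤ℚ q *ℚ ℕtoℚ (d ^ (2 * k ∸ 1))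
  scale d = ℚ.*-monoʳ-≤-nonNeg (ℕtoℚ (d ^ (2 * k ∸ 1))) {{ℕtoℚ-nonNeg (d ^ (2 * k ∸ 1))}}
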